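{- For every finite set $X$ define $L:\mathbb T_X\to\mathbb{SC}_X$ by $L(\mathcal T)=\sum_{C\in\mathcal L_{\mathcal T}}C$. Then $L$ is a surjective morphism of bialgebras in the category of coalgebra species, that is: (1) for all finite sets $X,Y$ (disjoint), $\mathcal T\in\mathbb T_X$, $\mathcal T'\in\mathbb T_Y$: $L(\mathcal T\mathcal T')=L(\mathcal T)L(\mathcal T')$; (2) for every finite set $X$ and $\mathcal T\in\mathbb T_X$: $\Delta\circ L(\mathcal T)=(L\otimes L)\circ\Delta(\mathcal T)$; (3) for every finite set $X$ and $\mathcal T\in\mathbb T_X$: $\rho\circ L(\mathcal T)=(L\otimes L)\circ\Gamma(\mathcal T)$; and each $L:\mathbb T_X\to\mathbb{SC}_X$ is surjective.
   Context: Topologies: for a finite set $X$, $\mathbb T_X$ is the vector space freely generated by topologies on $X$. For a topology $\mathcal T$, $x\le_{\mathcal T}y$ iff every open set containing $x$ contains $y$ (open sets = final segments); $x\sim_{\mathcal T}y$ iff $x\le_{\mathcal T}y\le_{\mathcal T}x$; $x<_{\mathcal T}y$ iff $x\le_{\mathcal T}y$ and not $y\le_{\mathcal T}x$; $\mathcal T|_Y=\{Z\cap Y:Z\in\mathcal T\}$; $Y$ is $\mathcal T$-connected if $(Y,\mathcal T|_Y)$ is connected. Product $\mathcal T\mathcal T'$ on $X\sqcup Y$: $Z$ open iff $Z\cap X\in\mathcal T$ and $Z\cap Y\in\mathcal T'$. $\Delta(\mathcal T)=\sum_{Y\in\mathcal T}\mathcal T|_{X\setminus Y}\otimes\mathcal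 T|_Y$. $\mathcal T'\prec\mathcal T$ means every $\mathcal T$-open is $\mathcal T'$-open; for such, $\mathcal T/\mathcal T'$ is the topology on $X$ whose quasi-order is the transitive closure of $x\,\mathcal R\,y\iff(x\le_{\mathcal T}y\text{ or }y\le_{\mathcal T'}x)$; $\mathcal T'$ is $\mathcal T$-admissible if $\mathcal T'\prec\mathcal T$, $\mathcal T'|_Y=\mathcal T|_Y$ for all $\mathcal T'$-connected $Y$, and $x\sim_{\mathcal T/\mathcal T'}y\iff x\sim_{\mathcal T'/\mathcal T'}y$. $\Gamma(\mathcal T)=\sum_{\mathcal T'\ \mathcal T\text{ -admissible}}\mathcal T'\otimes\mathcal T/\mathcal T'$. Set compositions: a set composition of $X$ is a sequence $(X_1,\dots,X_k)$ of nonempty sets with $X=X_1\sqcup\dots\sqcup X_k$; $\mathbb{SC}_X$ is the vector space they span. For $Y\subseteq X$ and $C=(X_1,\dots,X_k)$, let $\{i:X_i\cap Y\ne\emptyset\}=\{m_1<\dots<m_l\}$ and $C|_Y=(X_{m_1}\cap Y,\dots,X_{m_l}\cap Y)$. Product: for disjoint $X,Y$, $C'\in\mathbb{SC}_X$, $C''\in\mathbb{SC}_Y$, $C'C''=\sum C$ over set compositions $C$ of $X\sqcup Y$ with $C|_X=C'$ and $C|_Y=C''$. Coproduct $\Delta:\mathbb{SC}_X\to\bigoplus_{Y\subseteq X}\mathbb{SC}_{X\setminus Y}\otimes\mathbb{SC}_Y$, $\Delta(X_1,\dots,X_k)=\sum_{i=0}^k(X_1,\dots,X_i)\otimes(X_{i+1},\dots,X_k)$.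 Internal coproduct $\rho:\mathbb{SC}_X\to\mathbb{SC}_X\otimes\mathbb{SC}_X$: $\rho((X_1,\dots,X_k))=\sum_{i_1+\dots+i_p=k,\ i_j\ge1}(X_1,\dots,X_{i_1})\cdots(X_{i_1+\dots+i_{p-1}+1},\dots,X_k)\otimes(X_1\sqcup\dots\sqcup X_{i_1},\dots,X_{i_1+\dots+i_{p-1}+1}\sqcup\dots\sqcup X_k)$, the first factor being the product of set compositions of the disjoint blocks. Linear extensions: $C=(X_1,\dots,X_k)\in\mathbb{SC}_X$ is a linear extension of $\mathcal T$ if for $x\in X_i,y\in X_j$: $x<_{\mathcal T}y\Rightarrow i<j$ and $x\sim_{\mathcal T}y\Rightarrow i=j$. $\mathcal L_{\mathcal T}$ is the set of linear extensions of $\mathcal T$. -}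

module Defs where

open import Level using (Level; _⊔_) renaming (suc to lsuc)
open import Data.Bool using (Bool; true; false; _∧_; _∨_; not; if_then_else_; T)
import Data.Bool as Bool
open import Data.Nat using (ℕ; zero; suc; _<ᵇ_; _≡ᵇ_)
open import Data.Fin using (Fin)
open import Data.Fin.Subset using (Subset; _∪_; _∩_; ∁) renaming (⊥ to ∅)
open import Data.Vec using (Vec; []; _∷_; lookup)
import Data.Vec.Properties as VecP
open import Data.List using (List; []; _∷_; [_]; map; concatMap; _++_; filterᵇ;
  foldr; allFin; upTo; take; drop; length; zip)
open import Data.Bool.ListAction using (and; or)
import Data.List.Properties as ListP
open import Data.Product using (Σ; _×_; _,_; proj₁; proj₂; ∃)
import Data.Product.Properties as ProdP
open import Relation.Nullary using (¬_; Dec; yes; no)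
open import Relation.Binary.PropositionalEquality using (_≡_; refl; cong₂)
open import Relation.Binary.Definitions using (DecidableEquality)
open import Algebra.Bundles using (CommutativeRing)

record Field (c ℓ : Level) : Set (lsuc (c ⊔ ℓ)) where
  field
    commutativeRing : CommutativeRing c ℓ
  open CommutativeRing commutativeRing public
  field
    1≉0     : ¬ (1# ≈ 0#)
    inverse : ∀ x → ¬ (x ≈ 0#) → ∃ λ y → (x * y) ≈ 1#

-- Free K-vector spaces: a vector of the space with basis B is a finite
-- formal linear combination (list of coefficient/basis-element pairs);
-- two such are equal iff every basis element has the same coefficient.

module FreeVS {c ℓ : Level} (K : Field c ℓ) where
  open Field K

  Vect : Set → Set c
  Vect B = List (Carrier × B)

  coeff : {B : Set} → DecidableEquality B → B → Vect B → Carrier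
  coeff _≟_ b [] = 0#
  coeff _≟_ b ((r , b') ∷ v) with b ≟ b'
  ... | yes _ = r + coeff _≟_ b v
  ... | no  _ = coeff _≟_ b v

  Eq : {B : Set} → DecidableEquality B → Vect B → Vect B → Set ℓ
  Eq dec v w = ∀ b → coeff dec b v ≈ coeff dec b w

  single : {B : Set} → B → Vect B
  single b = [ (1# , b) ]

  sumᵥ : {B : Set} → List B → Vect B
  sumᵥ = map (λ b → (1# , b))

  scale : {B : Set} → Carrier → Vect B → Vect B
  scale r = map (λ p → (r * proj₁ p , proj₂ p))

  lin : {B B' : Set} → (B → Vect B') → Vect B → Vect B'
  lin f = concatMap (λ p → scale (proj₁ p) (f (proj₂ p)))

  bilin : {B₁ B₂ B' : Set} → (B₁ → B₂ → Vect B') → Vect B₁ → Vect B₂ → Vect B'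
  bilin f v w = concatMap (λ p → concatMap (λ q →
                  scale (proj₁ p * proj₁ q) (f (proj₂ p) (proj₂ q))) w) v

  _⊗ᵥ_ : {B₁ B₂ : Set} → Vect B₁ → Vect B₂ → Vect (B₁ × B₂)
  _⊗ᵥ_ = bilin (λ b c → single (b , c))

  _⊗ₗ_ : {B₁ B₂ C₁ C₂ : Set} → (B₁ → Vect C₁) → (B₂ → Vect C₂) →
         Vect (B₁ × B₂) → Vect (C₁ × C₂)
  (f ⊗ₗ g) = lin (λ p → f (proj₁ p) ⊗ᵥ g (proj₂ p))

-- Finite sets: a finite set is a subset X of some Fin N.

all : {A : Set} → (A → Bool) → List A → Bool
all p xs = and (map p xs)

any : {A : Set} → (A → Bool) → List A → Bool
any p xs = or (map p xs)

allSubsets : (n : ℕ) → List (Subset n)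
allSubsets zero    = [ [] ]
allSubsets (suc n) = map (true ∷_) (allSubsets n) ++ map (false ∷_) (allSubsets n)

_=ˢ_ : {n : ℕ} → Subset n → Subset n → Bool
[] =ˢ [] = true
(a ∷ U) =ˢ (b ∷ V) = ((a ∧ b) ∨ (not a ∧ not b)) ∧ (U =ˢ V)

_∈ᵇ_ : {n : ℕ} → Fin n → Subset n → Bool
x ∈ᵇ U = lookup U x

_⊆ᵇ_ : {n : ℕ} → Subset n → Subset n → Bool
_⊆ᵇ_ {n} U V = all (λ x → not (x ∈ᵇ U) ∨ (x ∈ᵇ V)) (allFin n)

nonempty : {n : ℕ} → Subset n → Bool
nonempty {n} U = any (λ x → x ∈ᵇ U) (allFin n)

_∖_ : {n : ℕ} → Subset n → Subset n → Subset n
X ∖ Y = X ∩ ∁ Y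

⋃ : {n : ℕ} → List (Subset n) → Subset n
⋃ = foldr _∪_ ∅

-- Families of subsets of Fin n, stored canonically as a binary trie
-- (so that propositional equality is equality of families).

Fam : ℕ → Set
Fam zero    = Bool
Fam (suc n) = Fam n × Fam n   -- (subsets containing 0 , subsets not containing 0)

memF : {n : ℕ} → Fam n → Subset n → Bool
memF {zero}  b       []          = b
memF {suc n} (p , q) (true  ∷ U) = memF p U
memF {suc n} (p , q) (false ∷ U) = memF q U

tabF : {n : ℕ} → (Subset n → Bool) → Fam n
tabF {zero}  f = f []
tabF {suc n} f = tabF (λ U → f (true ∷ U)) , tabF (λ U → f (false ∷ U))

allFams : (n : ℕ) → List (Fam n)
allFams zero    = true ∷ false ∷ []
allFams (suc n) = concatMap (λ p → map (p ,_) (allFams n)) (allFams n)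

_≟F_ : {n : ℕ} → DecidableEquality (Fam n)
_≟F_ {zero}  = Bool._≟_
_≟F_ {suc n} = ProdP.≡-dec _≟F_ _≟F_

_=ᶠ_ : {n : ℕ} → Fam n → Fam n → Bool
F =ᶠ G = Relation.Nullary.Dec.does (F ≟F G)

-- Topologies.  A topology on X ⊆ Fin N is a family 𝒯 of subsets of X
-- (its open sets) containing ∅ and X and closed under ∪ and ∩
-- (X finite, so finite unions/intersections suffice).

module _ {N : ℕ} where

  isTopᵇ : Subset N → Fam N → Bool
  isTopᵇ X 𝒯 =
    memF 𝒯 ∅ ∧ memF 𝒯 X
    ∧ all (λ U → not (memF 𝒯 U) ∨ (U ⊆ᵇ X)) (allSubsets N)
    ∧ all (λ U → all (λ V → not (memF 𝒯 U ∧ memF 𝒯 V)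
                             ∨ (memF 𝒯 (U ∪ V) ∧ memF 𝒯 (U ∩ V)))
                     (allSubsets N)) (allSubsets N)

  IsTopology : Subset N → Fam N → Set
  IsTopology X 𝒯 = T (isTopᵇ X 𝒯)

  opens : Fam N → List (Subset N)
  opens 𝒯 = filterᵇ (memF 𝒯) (allSubsets N)

  -- the underlying set of a topology (its largest open set)
  ground : Fam N → Subset N
  ground 𝒯 = ⋃ (opens 𝒯)

  _≤⟨_⟩_ : Fin N → Fam N → Fin N → Bool
  x ≤⟨ 𝒯 ⟩ y = all (λ U → not (memF 𝒯 U ∧ (x ∈ᵇ U)) ∨ (y ∈ᵇ U)) (allSubsets N)

  _∼⟨_⟩_ : Fin N → Fam N → Fin N → Bool
  x ∼⟨ 𝒯 ⟩ y = (x ≤⟨ 𝒯 ⟩ y) ∧ (y ≤⟨ 𝒯 ⟩ x)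

  _<⟨_⟩_ : Fin N → Fam N → Fin N → Bool
  x <⟨ 𝒯 ⟩ y = (x ≤⟨ 𝒯 ⟩ y) ∧ not (y ≤⟨ 𝒯 ⟩ x)

  _∣_ : Fam N → Subset N → Fam N
  𝒯 ∣ Y = tabF (λ W → any (λ Z → memF 𝒯 Z ∧ ((Z ∩ Y) =ˢ W)) (allSubsets N))

  connectedᵇ : Fam N → Subset N → Bool
  connectedᵇ 𝒯 Y = not (any (λ U → any (λ V →
       memF (𝒯 ∣ Y) U ∧ memF (𝒯 ∣ Y) V ∧ nonempty U ∧ nonempty V
       ∧ ((U ∩ V) =ˢ ∅) ∧ ((U ∪ V) =ˢ Y)) (allSubsets N)) (allSubsets N))

  topProd : Subset N → Subset N → Fam N → Fam N → Fam N
  topProd X Y 𝒯 𝒯' = tabF (λ Z → (Z ⊆ᵇ (X ∪ Y)) ∧ memF 𝒯 (Z ∩ X) ∧ memF 𝒯' (Z ∩ Y))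

  -- transitive closure on X of a relation R on X (paths of ≤ N+1 steps
  -- suffice since X has at most N elements)
  transClos : Subset N → (Fin N → Fin N → Bool) → Fin N → Fin N → Bool
  transClos X R = go N
    where
    go : ℕ → Fin N → Fin N → Bool
    go zero    x y = R x y
    go (suc k) x y = go k x y ∨ any (λ z → (z ∈ᵇ X) ∧ go k x z ∧ R z y) (allFin N)

  topOfQO : Subset N → (Fin N → Fin N → Bool) → Fam N
  topOfQO X Q = tabF (λ Z → (Z ⊆ᵇ X) ∧
     all (λ x → all (λ y → not ((x ∈ᵇ Z) ∧ Q x y) ∨ (y ∈ᵇ Z)) (allFin N)) (allFin N))

  quot : Subset N → Fam N → Fam N → Fam N
  quot X 𝒯 𝒯' = topOfQO X (transClos X (λ x y →
      (x ∈ᵇ X) ∧ (y ∈ᵇ X) ∧ ((x ≤⟨ 𝒯 ⟩ y) ∨ (y ≤⟨ 𝒯' ⟩ x))))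

  _≺ᵇ_ : Fam N → Fam N → Bool
  𝒯' ≺ᵇ 𝒯 = all (λ U → not (memF 𝒯 U) ∨ memF 𝒯' U) (allSubsets N)

  admissibleᵇ : Subset N → Fam N → Fam N → Bool
  admissibleᵇ X 𝒯 𝒯' =
    isTopᵇ X 𝒯' ∧ (𝒯' ≺ᵇ 𝒯)
    ∧ all (λ Y → not ((Y ⊆ᵇ X) ∧ connectedᵇ 𝒯' Y) ∨ ((𝒯' ∣ Y) =ᶠ (𝒯 ∣ Y))) (allSubsets N)
    ∧ all (λ x → all (λ y → not ((x ∈ᵇ X) ∧ (y ∈ᵇ X)) ∨
          iff (x ∼⟨ quot X 𝒯 𝒯' ⟩ y) (x ∼⟨ quot X 𝒯' 𝒯' ⟩ y)) (allFin N)) (allFin N)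
    where
    iff : Bool → Bool → Bool
    iff a b = (a ∧ b) ∨ (not a ∧ not b)

-- Set compositions: a set composition of X ⊆ Fin N is a list
-- (X₁ , … , X_k) of nonempty pairwise disjoint subsets with union X.

SC : ℕ → Set
SC N = List (Subset N)

_≟SC_ : {N : ℕ} → DecidableEquality (SC N)
_≟SC_ = ListP.≡-dec (VecP.≡-dec Bool._≟_)

module _ {N : ℕ} where

  isSCᵇ : Subset N → SC N → Bool
  isSCᵇ X C = all nonempty C ∧ all (λ x →
      if x ∈ᵇ X then exactlyOne (filterᵇ (λ B → x ∈ᵇ B) C)
                else noneIn (filterᵇ (λ B → x ∈ᵇ B) C)) (allFin N)
    where
    exactlyOne : SC N → Bool
    exactlyOne (_ ∷ []) = true
    exactlyOne _        = false
    noneIn : SC N → Bool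
    noneIn [] = true
    noneIn _  = false

  IsSetComposition : Subset N → SC N → Set
  IsSetComposition X C = T (isSCᵇ X C)

  -- all lists of at most k subsets of Fin N (each exactly once)
  listsUpTo : ℕ → List (SC N)
  listsUpTo zero    = [ [] ]
  listsUpTo (suc k) = [] ∷ concatMap (λ B → map (B ∷_) (listsUpTo k)) (allSubsets N)

  -- all set compositions of X (they have at most N blocks)
  allSC : Subset N → List (SC N)
  allSC X = filterᵇ (isSCᵇ X) (listsUpTo N)

  restrictSC : SC N → Subset N → SC N
  restrictSC C Y = filterᵇ nonempty (map (_∩ Y) C)

  isLinExtᵇ : Subset N → Fam N → SC N → Bool
  isLinExtᵇ X 𝒯 C = isSCᵇ X C ∧
    all (λ iA → all (λ jB → all (λ x → all (λ y →
        not ((x ∈ᵇ proj₂ iA) ∧ (y ∈ᵇ proj₂ jB)) ∨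
        ((not (x <⟨ 𝒯 ⟩ y) ∨ (proj₁ iA <ᵇ proj₁ jB)) ∧
         (not (x ∼⟨ 𝒯 ⟩ y) ∨ (proj₁ iA ≡ᵇ proj₁ jB))))
      (allFin N)) (allFin N)) ic) ic
    where
    ic : List (ℕ × Subset N)
    ic = zip (upTo (length C)) C

  linExts : Fam N → List (SC N)
  linExts 𝒯 = filterᵇ (isLinExtᵇ (ground 𝒯) 𝒯) (allSC (ground 𝒯))

segmentations : {A : Set} → List A → List (List (List A))
segmentations []       = [ [] ]
segmentations (a ∷ as) = concatMap (λ s → ([ a ] ∷ s) ∷ joinFirst s) (segmentations as)
  where
  joinFirst : List (List _) → List (List (List _))
  joinFirst []       = []
  joinFirst (b ∷ bs) = [ (a ∷ b) ∷ bs ]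


module Maps {c ℓ : Level} (K : Field c ℓ) {N : ℕ} where
  open FreeVS K public

  Vec𝕋 : Set c
  Vec𝕋 = Vect (Fam N)

  Vec𝕊ℂ : Set c
  Vec𝕊ℂ = Vect (SC N)

  _≈𝕊ℂ_ : Vec𝕊ℂ → Vec𝕊ℂ → Set ℓ
  _≈𝕊ℂ_ = Eq _≟SC_

  _≈𝕊ℂ⊗𝕊ℂ_ : Vect (SC N × SC N) → Vect (SC N × SC N) → Set ℓ
  _≈𝕊ℂ⊗𝕊ℂ_ = Eq (ProdP.≡-dec (_≟SC_ {N}) (λ {_} → _≟SC_ {N}))

  L : Fam N → Vec𝕊ℂ
  L 𝒯 = sumᵥ (linExts 𝒯)

  Lˡ : Vec𝕋 → Vec𝕊ℂ
  Lˡ = lin L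

  -- product of set compositions C' (of X = ⋃ C') and C'' (of Y = ⋃ C'')
  scProd : SC N → SC N → Vec𝕊ℂ
  scProd C' C'' = sumᵥ (filterᵇ
      (λ C → Relation.Nullary.Dec.does (restrictSC C (⋃ C') ≟SC C')
           ∧ Relation.Nullary.Dec.does (restrictSC C (⋃ C'') ≟SC C''))
      (allSC (⋃ C' ∪ ⋃ C'')))

  _·_ : Vec𝕊ℂ → Vec𝕊ℂ → Vec𝕊ℂ
  _·_ = bilin scProd

  ΔSC : SC N → Vect (SC N × SC N)
  ΔSC C = sumᵥ (map (λ i → (take i C , drop i C)) (upTo (suc (length C))))

  Δ𝕋 : Subset N → Fam N → Vect (Fam N × Fam N)
  Δ𝕋 X 𝒯 = sumᵥ (map (λ Y → (𝒯 ∣ (X ∖ Y) , 𝒯 ∣ Y)) (opens 𝒯))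

  prodMany : List (SC N) → Vec𝕊ℂ
  prodMany []       = single []
  prodMany (C ∷ Cs) = single C · prodMany Cs

  ρSC : SC N → Vect (SC N × SC N)
  ρSC C = concatMap (λ segs → prodMany segs ⊗ᵥ single (map ⋃ segs)) (segmentations C)

  Γ : Subset N → Fam N → Vect (Fam N × Fam N)
  Γ X 𝒯 = sumᵥ (map (λ 𝒯' → (𝒯' , quot X 𝒯 𝒯')) (filterᵇ (admissibleᵇ X 𝒯) (allFams N)))

{-# OPTIONS --safe #-}
module Submission where

-- Every vector in the theorem is a multiplicity-free sum of basis elements, so each identity reduces
-- to comparing two sets.  A set composition C is handled through the total preorder x ≼ y given by
-- the index of the block, and C is a linear extension of 𝒯 iff x ≤ y implies x ≼ y, and moreover
-- y ≤ x as soon as y ≼ x.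
--
-- (1) C is a linear extension of 𝒯𝒯' iff its restrictions to X and Y are linear extensions of 𝒯 and 𝒯'.
-- (2) A ++ B is a linear extension of 𝒯 iff Y = ⋃ B is open and A, B are linear extensions of the
--     restrictions of 𝒯 to X ∖ Y and Y.
-- (3) D ⊗ E occurs in ρ(L(𝒯)) iff the composition obtained by refining each block of E by D is a
--     linear extension of 𝒯.  It occurs in (L ⊗ L)(Γ(𝒯)) iff D and E are linear extensions of 𝒯' and
--     𝒯/𝒯' for an admissible 𝒯'; such a 𝒯' must be 𝒯 cut along the blocks of E, hence is unique,
--     and under the first condition the cut topology is indeed such a 𝒯'.
-- (4) C is the only linear extension of the topology of its own total preorder.

open import Defs
open import Level using (Level; _⊔_)
open import Data.Bool using (Bool; true; false; T; _∧_; _∨_; if_then_else_)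
open import Data.Bool.Properties using (T-∧)
open import Data.Empty using (⊥-elim)
open import Data.Fin using (Fin)
open import Data.Fin.Subset using (Subset; _∩_; _∪_; Nonempty; _⊆_) renaming (∣_∣ to size; ⊥ to ∅; _∈_ to _∈ˢ_; _∉_ to _∉ˢ_)
open import Data.Fin.Subset.Properties using (_∈?_; ∉⊥; ⊥⊆; ⊆-antisym; x∈p∩q⁺; x∈p∩q⁻; x∈p∪q⁺; x∈p∪q⁻; x∈∁p⇒x∉p; x∉p⇒x∈∁p; p⊂q⇒∣p∣<∣q∣; ∩-comm; ∪-comm; ∣p∣≤n; nonempty?)
open import Data.List using (List; []; _∷_; map; concatMap; concat; _++_; allFin; tabulate; filterᵇ; foldr; length; filter; zip; upTo; applyUpTo; take; drop)
import Data.List.Membership.DecPropositional as DecMembership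
open import Data.List.Membership.Propositional using (_∈_; lose; find)
open import Data.List.Membership.Propositional.Properties using (∈-map⁺; ∈-map⁻; ∈-++⁺ˡ; ∈-++⁺ʳ; ∈-concatMap⁺; ∈-concatMap⁻; ∈-allFin; ∈-filter⁺; ∈-filter⁻; ∈-upTo⁺; ∈-upTo⁻)
open import Data.List.Properties using (map-++; map-∘; map-id; filter-accept; filter-reject; ∷-injective; ∷-injectiveʳ; ∷-injectiveˡ; take++drop≡id; length-take; length-++)
open import Data.List.Relation.Unary.All as All using (All; []; _∷_)
import Data.List.Relation.Unary.All.Properties as Allₚ
open import Data.List.Relation.Unary.Any using (here; there)
open import Data.List.Relation.Unary.Unique.Propositional using (Unique; []; _∷_)
import Data.List.Relation.Unary.Unique.Propositional.Properties as Uniqueₚ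
import Data.Nat as ℕ
open import Data.Nat using (ℕ; zero; suc; _≤_; _<_; z≤n; s≤s; s≤s⁻¹; _≤?_; _<?_; _≟_)
open import Data.Nat.Properties using (≤-refl; ≤-reflexive; ≤-trans; ≤-total; ≤-antisym; <⇒≤; <⇒≱; ≰⇒>; m≤m+n; +-monoʳ-≤; +-cancelˡ-≤; m≤n⇒m⊓n≡m)
open import Data.Product using (Σ; ∃; _×_; _,_; proj₁; proj₂; map₂)
open import Data.Sum as Sum using (_⊎_; inj₁; inj₂)
open import Data.Unit using (tt)
open import Data.Vec as Vec using ([]; _∷_; lookup)
open import Data.Vec.Properties using (lookup⇒[]=; []=⇒lookup; lookup∘tabulate)
open import Function using (_∘_; id; _⇔_; mk⇔; Equivalence)
open import Relation.Binary.Definitions using (DecidableEquality)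
open import Relation.Binary.PropositionalEquality using (_≡_; _≢_; refl; sym; trans; cong; cong₂; subst; subst₂)
open import Relation.Nullary using (¬_; Dec; yes; no; does; _because_; proof; Reflects; ofʸ; ofⁿ)
open import Relation.Nullary.Decidable using (T?; _×-dec_; _→-dec_; ¬?)
open import Relation.Nullary.Negation using (contradiction)
open import Relation.Nullary.Reflects using (_×-reflects_; _→-reflects_; ¬-reflects; _⊎-reflects_; T-reflects)

open Equivalence using (to; from)

-- Equal supports give equal vectors only when no basis element is produced twice: a repeated
-- element would have coefficient 1 + 1, which is never 1 in a field. Each linear extension of a map
-- to vectors therefore carries a proof that a term of the result remembers where it came from. For
-- the product, the factors are restrictions of C; for the coproduct, Y is the union of the second
-- factor; for the internal coproduct, the segmentation is determined by D and E on one side, and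
-- the admissible topology on the other. This is why its uniqueness matters as much as its
-- existence. Why it must be the cut: a relation x ≤ y of 𝒯' is reversed in 𝒯/𝒯', which forces y ≼ x
-- in E. Conversely, let x ≤ y in 𝒯 with y ≼ x in E. As E is a linear extension of 𝒯/𝒯', the points
-- are equivalent there, hence by admissibility in 𝒯'/𝒯', whose classes are the connected components
-- of 𝒯'; on a component 𝒯' and 𝒯 agree, so x ≤ y in 𝒯'.

private
  variable
    A A' A'' : Set
    P Q : Set
    β : Bool
    n N : ℕ
    x y : Fin N
    B U V W X Y Z : Subset N
    C D E : SC N

-- Reflection of the Boolean definitions

reflect-T : Reflects P β → T β → P
reflect-T (ofʸ p) _ = p

T-reflect : Reflects P β → P → T β
T-reflect (ofʸ _)  _ = tt
T-reflect (ofⁿ ¬p) p = ¬p p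

reflects-map : (P → Q) → (Q → P) → Reflects P β → Reflects Q β
reflects-map f g (ofʸ p)  = ofʸ (f p)
reflects-map f g (ofⁿ ¬p) = ofⁿ (¬p ∘ g)

all-∈-reflects : {P : A → Set} {p : A → Bool} → (∀ x → Reflects (P x) (p x)) →
                 ∀ xs → Reflects (∀ x → x ∈ xs → P x) (all p xs)
all-∈-reflects r []       = ofʸ λ _ ()
all-∈-reflects r (x ∷ xs) = reflects-map
  (λ { (px , _) _ (here refl) → px ; (_ , pxs) y (there y∈) → pxs y y∈ })
  (λ h → h x (here refl) , λ y y∈ → h y (there y∈))
  (r x ×-reflects all-∈-reflects r xs)

any-∈-reflects : {P : A → Set} {p : A → Bool} → (∀ x → Reflects (P x) (p x)) →
                 ∀ xs → Reflects (∃ λ x → x ∈ xs × P x) (any p xs)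
any-∈-reflects r []       = ofⁿ λ { (_ , () , _) }
any-∈-reflects r (x ∷ xs) = reflects-map
  (λ { (inj₁ px) → x , here refl , px ; (inj₂ (y , y∈ , py)) → y , there y∈ , py })
  (λ { (_ , here refl , px) → inj₁ px ; (y , there y∈ , py) → inj₂ (y , y∈ , py) })
  (r x ⊎-reflects any-∈-reflects r xs)

all-reflects : {P : A → Set} {p : A → Bool} {xs : List A} → (∀ x → x ∈ xs) →
               (∀ x → Reflects (P x) (p x)) → Reflects (∀ x → P x) (all p xs)
all-reflects {xs = xs} complete r =
  reflects-map (λ h x → h x (complete x)) (λ h x _ → h x) (all-∈-reflects r xs)

any-reflects : {P : A → Set} {p : A → Bool} {xs : List A} → (∀ x → x ∈ xs) →
               (∀ x → Reflects (P x) (p x)) → Reflects (∃ P) (any p xs)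
any-reflects {xs = xs} complete r =
  reflects-map (λ { (x , _ , px) → x , px }) (λ { (x , px) → x , complete x , px })
               (any-∈-reflects r xs)

-- Multiplicity-free vectors

concatMap-∈-⇔ : ∀ {a b} {A : Set a} {A' : Set b} {f : A → List A'} {y : A'} {xs : List A} →
                y ∈ concatMap f xs ⇔ (∃ λ x → x ∈ xs × y ∈ f x)
concatMap-∈-⇔ {f = f} {xs = xs} = mk⇔
  (λ y∈ → find (∈-concatMap⁻ f {xs = xs} y∈))
  (λ { (x , x∈ , y∈) → ∈-concatMap⁺ f (lose x∈ y∈) })

concatMap-unique : {f : A → List A'} {xs : List A} → Unique xs →
                   (∀ {x} → x ∈ xs → Unique (f x)) →
                   (∀ {x x' y} → x ∈ xs → x' ∈ xs → y ∈ f x → y ∈ f x' → x ≡ x') →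
                   Unique (concatMap f xs)
concatMap-unique []                   u d = []
concatMap-unique {f = f} {xs = x ∷ xs} (x∉ ∷ uxs) u d = Uniqueₚ.++⁺ (u (here refl))
  (concatMap-unique uxs (u ∘ there) λ p q → d (there p) (there q))
  λ { (y∈ , y∈') → let x' , x'∈ , y∈'' = to concatMap-∈-⇔ y∈' in
      All.lookup x∉ x'∈ (d (here refl) (there x'∈) y∈ y∈'') }

map-unique : {f : A → A'} {xs : List A} → Unique xs →
             (∀ {x x'} → x ∈ xs → x' ∈ xs → f x ≡ f x' → x ≡ x') → Unique (map f xs)
map-unique []         inj = []
map-unique {f = f} {xs = x ∷ xs} (x∉ ∷ u) inj =
  All.tabulate (λ y∈ fx≡y → let x' , x'∈ , y≡ = ∈-map⁻ f y∈ in
    All.lookup x∉ x'∈ (inj (here refl) (there x'∈) (trans fx≡y y≡)))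
  ∷ map-unique u λ p q → inj (there p) (there q)

module Representation {c ℓ : Level} (K : Field c ℓ) where
  open Field K using (Carrier; _≈_; 1#; 0#; _+_; _*_; +-cong; +-congˡ; +-identityˡ; +-identityʳ; +-assoc; *-cong; *-identityˡ; distribˡ; zeroʳ)
    renaming (refl to ≈-refl; sym to ≈-sym; trans to ≈-trans)
  open FreeVS K

  support : Vect A → List A
  support = map proj₂

  -- The indicator vector of `P`: a list with unit coefficients and no repetition, so each
  -- coefficient is 1 or 0 according to `P`, and two vectors with the same `P` are equal. Unit
  -- coefficients are required only up to `≈`, since scaling produces products of ones.
  record _Represents_ {A : Set} (v : Vect A) (P : A → Set) : Set (c ⊔ ℓ) where
    field
      unit     : All (λ p → proj₁ p ≈ 1#) v
      distinct : Unique (support v)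
      member   : ∀ a → a ∈ support v ⇔ P a

  open _Represents_ public

  represents-cong : {v : Vect A} {P Q : A → Set} → (∀ a → P a ⇔ Q a) → v Represents P → v Represents Q
  represents-cong e r = record
    { unit = unit r
    ; distinct = distinct r
    ; member = λ a → mk⇔ (to (e a) ∘ to (member r a)) (from (member r a) ∘ from (e a)) }

  sumᵥ-represents : {xs : List A} {P : A → Set} → Unique xs → (∀ a → a ∈ xs ⇔ P a) →
                    sumᵥ xs Represents P
  sumᵥ-represents {xs = xs} {P} u m = record
    { unit = Allₚ.map⁺ (All.universal (λ _ → ≈-refl) xs)
    ; distinct = subst Unique (sym (support-sumᵥ xs)) u
    ; member = λ a → subst (λ ys → a ∈ ys ⇔ P a) (sym (support-sumᵥ xs)) (m a) }
    where
    support-sumᵥ : (xs : List A) → support (sumᵥ xs) ≡ xs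
    support-sumᵥ []       = refl
    support-sumᵥ (x ∷ xs) = cong (x ∷_) (support-sumᵥ xs)

  single-represents : (a : A) → single a Represents (_≡ a)
  single-represents a = sumᵥ-represents ([] ∷ []) λ _ → mk⇔ (λ { (here e) → e ; (there ()) }) here

  scale-represents : ∀ {r} {v : Vect A} {P : A → Set} → r ≈ 1# → v Represents P → scale r v Represents P
  scale-represents {r = r} {v} {P} r≈1 R = record
    { unit = Allₚ.map⁺ (All.map (λ s≈1 → ≈-trans (*-cong r≈1 s≈1) (*-identityˡ 1#)) (unit R))
    ; distinct = subst Unique support-scale (distinct R)
    ; member = λ a → subst (λ ys → a ∈ ys ⇔ P a) support-scale (member R a) }
    where
    support-scale : support v ≡ support (scale r v)
    support-scale = map-∘ v

  -- The last hypothesis keeps the supports of different summands disjoint, so coefficients never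
  -- add up beyond 1. The map `κ` reads the basis element off an index: it is `proj₂` when summing
  -- over the terms of a vector and `id` when summing over segmentations.
  concatMap-represents : ∀ {i} {I : Set i} {κ : I → A} {g : I → Vect A'} {is : List I} {P : A → Set} {Q : A → A' → Set} →
    Unique (map κ is) → (∀ a → a ∈ map κ is ⇔ P a) →
    (∀ {i} → i ∈ is → g i Represents Q (κ i)) →
    (∀ {a a' b} → P a → P a' → Q a b → Q a' b → a ≡ a') →
    concatMap g is Represents (λ b → ∃ λ a → P a × Q a b)
  concatMap-represents {κ = κ} {g} {is = is} {P} {Q} u m r d = record
    { unit = Allₚ.concat⁺ (Allₚ.map⁺ (All.tabulate λ i∈ → unit (r i∈)))
    ; distinct = go is u r λ a a∈ → to (m a) a∈
    ; member = λ b → mk⇔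
        (λ b∈ → let p , p∈ , b≡ = ∈-map⁻ proj₂ b∈
                    i , i∈ , p∈gi = to (concatMap-∈-⇔ {xs = is}) p∈
                in κ i , to (m _) (∈-map⁺ κ i∈)
                 , to (member (r i∈) b) (subst (_∈ support (g i)) (sym b≡) (∈-map⁺ proj₂ p∈gi)))
        (λ { (a , pa , qab) → let i , i∈ , a≡ = ∈-map⁻ κ (from (m a) pa)
                                  p , p∈ , b≡ = ∈-map⁻ proj₂ (from (member (r i∈) b) (subst (λ a → Q a b) a≡ qab))
                              in subst (_∈ support (concatMap g is)) (sym b≡)
                                   (∈-map⁺ proj₂ (from concatMap-∈-⇔ (i , i∈ , p∈))) }) }
    where
    go : ∀ is → Unique (map κ is) → (∀ {i} → i ∈ is → g i Represents Q (κ i)) →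
         (∀ a → a ∈ map κ is → P a) → Unique (support (concatMap g is))
    go []       _          _ _ = []
    go (i ∷ is) (i∉ ∷ uis) r p = subst Unique (sym (map-++ proj₂ (g i) (concatMap g is)))
      (Uniqueₚ.++⁺ (distinct (r (here refl))) (go is uis (r ∘ there) λ a a∈ → p a (there a∈))
        λ { {b} (b∈ , b∈') →
          let q , q∈ , b≡ = ∈-map⁻ proj₂ b∈'
              j , j∈ , q∈gj = to (concatMap-∈-⇔ {xs = is}) q∈
          in All.lookup i∉ (∈-map⁺ κ j∈)
               (d (p _ (here refl)) (p _ (there (∈-map⁺ κ j∈))) (to (member (r (here refl)) b) b∈)
                  (to (member (r (there j∈)) b) (subst (_∈ support (g j)) (sym b≡) (∈-map⁺ proj₂ q∈gj)))) })

  lin-represents : {v : Vect A} {f : A → Vect A'} {P : A → Set} {Q : A → A' → Set} →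
    v Represents P → (∀ {a} → P a → f a Represents Q a) →
    (∀ {a a' b} → P a → P a' → Q a b → Q a' b → a ≡ a') →
    lin f v Represents (λ b → ∃ λ a → P a × Q a b)
  lin-represents R S = concatMap-represents (distinct R) (member R) λ p∈ →
    scale-represents (All.lookup (unit R) p∈) (S (to (member R _) (∈-map⁺ proj₂ p∈)))

  bilin-represents : {v : Vect A} {w : Vect A'} {f : A → A' → Vect A''}
    {P : A → Set} {Q : A' → Set} {R : A → A' → A'' → Set} →
    v Represents P → w Represents Q → (∀ {a b} → P a → Q b → f a b Represents R a b) →
    (∀ {a a' b b' c} → P a → P a' → Q b → Q b' → R a b c → R a' b' c → a ≡ a' × b ≡ b') →
    bilin f v w Represents (λ c → ∃ λ a → P a × ∃ λ b → Q b × R a b c)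
  bilin-represents V W F d = concatMap-represents (distinct V) (member V)
    (λ p∈ → concatMap-represents (distinct W) (member W)
      (λ q∈ → scale-represents
         (≈-trans (*-cong (All.lookup (unit V) p∈) (All.lookup (unit W) q∈)) (*-identityˡ 1#))
         (F (to (member V _) (∈-map⁺ proj₂ p∈)) (to (member W _) (∈-map⁺ proj₂ q∈))))
      -- With the outer term fixed, joint injectivity is applied with `pa` on both sides to separate
      -- the inner summands.
      λ qb qb' r r' → let pa = to (member V _) (∈-map⁺ proj₂ p∈) in proj₂ (d pa pa qb qb' r r'))
    λ { pa pa' (_ , qb , r) (_ , qb' , r') → proj₁ (d pa pa' qb qb' r r') }

  ⊗-represents : {v : Vect A} {w : Vect A'} {P : A → Set} {Q : A' → Set} →
    v Represents P → w Represents Q → (v ⊗ᵥ w) Represents (λ p → P (proj₁ p) × Q (proj₂ p))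
  ⊗-represents V W = represents-cong
    (λ { (a , b) → mk⇔ (λ { (_ , pa , _ , qb , refl) → pa , qb })
                       (λ { (pa , qb) → _ , pa , _ , qb , refl }) })
    (bilin-represents V W (λ _ _ → single-represents _) λ { _ _ _ _ refl refl → refl , refl })

  coeff-∈ : (dec : DecidableEquality A) {v : Vect A} → ∀ {a} → All (λ p → proj₁ p ≈ 1#) v →
    Unique (support v) → a ∈ support v → coeff dec a v ≈ 1#
  coeff-∉ : (dec : DecidableEquality A) {v : Vect A} → ∀ {a} →
    ¬ (a ∈ support v) → coeff dec a v ≈ 0#
  coeff-∉ dec {[]} a∉ = ≈-refl
  coeff-∉ dec {(r , a') ∷ v} {a} a∉ with dec a a'
  ... | yes refl = contradiction (here refl) a∉
  ... | no _     = coeff-∉ dec {v} (a∉ ∘ there)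
  coeff-∈ dec {(r , a') ∷ v} {a} (r≈1 ∷ us) (a'∉ ∷ u) a∈ with dec a a' | a∈
  ... | yes refl | _ = ≈-trans (+-cong r≈1 (coeff-∉ dec {v} λ a∈v → All.lookup a'∉ a∈v refl)) (+-identityʳ 1#)
  ... | no a≢    | here a≡  = contradiction a≡ a≢
  ... | no _     | there a∈v = coeff-∈ dec us u a∈v

  represents⇒Eq : (dec : DecidableEquality A) {v w : Vect A} {P : A → Set} →
                  v Represents P → w Represents P → Eq dec v w
  represents⇒Eq dec {v} {w} V W a with DecMembership._∈?_ dec a (support v)
  ... | yes a∈ = ≈-trans (coeff-∈ dec (unit V) (distinct V) a∈)
    (≈-sym (coeff-∈ dec (unit W) (distinct W) (from (member W a) (to (member V a) a∈))))
  ... | no a∉  = ≈-trans (coeff-∉ dec {v} a∉)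
    (≈-sym (coeff-∉ dec {w} λ a∈ → a∉ (from (member V a) (to (member W a) a∈))))

  coeff-++ : (dec : DecidableEquality A) (a : A) (v w : Vect A) → coeff dec a (v ++ w) ≈ coeff dec a v + coeff dec a w
  coeff-++ dec a []            w = ≈-sym (+-identityˡ _)
  coeff-++ dec a ((r , b) ∷ v) w with dec a b
  ... | yes _ = ≈-trans (+-congˡ (coeff-++ dec a v w)) (≈-sym (+-assoc _ _ _))
  ... | no _  = coeff-++ dec a v w

  coeff-scale : (dec : DecidableEquality A) (a : A) (r : Carrier) (v : Vect A) → coeff dec a (scale r v) ≈ r * coeff dec a v
  coeff-scale dec a r []            = ≈-sym (zeroʳ r)
  coeff-scale dec a r ((s , b) ∷ v) with dec a b
  ... | yes _ = ≈-trans (+-congˡ (coeff-scale dec a r v)) (≈-sym (distribˡ r s _))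
  ... | no _  = coeff-scale dec a r v

-- Enumerations

∈-allSubsets : (U : Subset n) → U ∈ allSubsets n
∈-allSubsets []          = here refl
∈-allSubsets (true ∷ U)  = ∈-++⁺ˡ (∈-map⁺ (true ∷_) (∈-allSubsets U))
∈-allSubsets (false ∷ U) = ∈-++⁺ʳ _ (∈-map⁺ (false ∷_) (∈-allSubsets U))

allSubsets-unique : ∀ n → Unique (allSubsets n)
allSubsets-unique zero    = [] ∷ []
allSubsets-unique (suc n) = Uniqueₚ.++⁺
  (Uniqueₚ.map⁺ (cong Vec.tail) (allSubsets-unique n))
  (Uniqueₚ.map⁺ (cong Vec.tail) (allSubsets-unique n))
  λ { (p , q) → case-heads (∈-map⁻ (true ∷_) p) (∈-map⁻ (false ∷_) q) }
  where
  case-heads : ∀ {U : Subset (suc n)} → (∃ λ V → V ∈ allSubsets n × U ≡ true ∷ V) →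
               (∃ λ V → V ∈ allSubsets n × U ≡ false ∷ V) → _
  case-heads (_ , _ , refl) (_ , _ , ())

∈-allFams : (F : Fam n) → F ∈ allFams n
∈-allFams {zero}  true    = here refl
∈-allFams {zero}  false   = there (here refl)
∈-allFams {suc n} (F , G) = from concatMap-∈-⇔ (F , ∈-allFams F , ∈-map⁺ (F ,_) (∈-allFams G))

allFams-unique : ∀ n → Unique (allFams n)
allFams-unique zero    = ((λ ()) ∷ []) ∷ [] ∷ []
allFams-unique (suc n) = concatMap-unique (allFams-unique n)
  (λ _ → Uniqueₚ.map⁺ (cong proj₂) (allFams-unique n))
  λ _ _ p q → trans (sym (cong proj₁ (proj₂ (proj₂ (∈-map⁻ _ p))))) (cong proj₁ (proj₂ (proj₂ (∈-map⁻ _ q))))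

∈-listsUpTo : ∀ k (C : SC N) → length C ≤ k → C ∈ listsUpTo k
∈-listsUpTo zero    []      _       = here refl
∈-listsUpTo (suc k) []      _       = here refl
∈-listsUpTo (suc k) (B ∷ C) (s≤s l) = there
  (from concatMap-∈-⇔ (B , ∈-allSubsets B , ∈-map⁺ (B ∷_) (∈-listsUpTo k C l)))

listsUpTo-unique : ∀ k → Unique (listsUpTo {N} k)
listsUpTo-unique zero    = [] ∷ []
listsUpTo-unique {N} (suc k) =
  All.tabulate (λ { C∈ refl → []∉ (to (concatMap-∈-⇔ {xs = allSubsets N}) C∈) })
  ∷ concatMap-unique (allSubsets-unique N)
      (λ _ → Uniqueₚ.map⁺ (λ { refl → refl }) (listsUpTo-unique k))
      λ _ _ p q → same-head (∈-map⁻ _ p) (∈-map⁻ _ q)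
  where
  []∉ : ¬ (∃ λ B → B ∈ allSubsets N × [] ∈ map (B ∷_) (listsUpTo k))
  []∉ (B , _ , p) with ∈-map⁻ (B ∷_) p
  ... | _ , _ , ()
  same-head : ∀ {A B : Subset N} {C} → (∃ λ D → D ∈ listsUpTo k × C ≡ A ∷ D) → (∃ λ D → D ∈ listsUpTo k × C ≡ B ∷ D) → A ≡ B
  same-head (_ , _ , refl) (_ , _ , refl) = refl

filterᵇ-∈-⇔ : ∀ {A : Set} {P : A → Set} {p : A → Bool} → (∀ x → Reflects (P x) (p x)) →
              ∀ {x xs} → x ∈ filterᵇ p xs ⇔ (x ∈ xs × P x)
filterᵇ-∈-⇔ {p = p} r {x} = mk⇔
  (λ x∈ → let x∈xs , px = ∈-filter⁻ (T? ∘ p) x∈ in x∈xs , reflect-T (r x) px)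
  λ { (x∈xs , px) → ∈-filter⁺ (T? ∘ p) x∈xs (T-reflect (r x) px) }

-- Subsets

∈-reflects : ∀ (x : Fin N) U → Reflects (x ∈ˢ U) (x ∈ᵇ U)
∈-reflects x U with lookup U x in eq
... | true  = ofʸ (lookup⇒[]= x U eq)
... | false = ofⁿ λ x∈ → contradiction (trans (sym eq) ([]=⇒lookup x∈)) λ ()

=ˢ-reflects : ∀ (U V : Subset n) → Reflects (U ≡ V) (U =ˢ V)
=ˢ-reflects []          []          = ofʸ refl
=ˢ-reflects (true ∷ U)  (true ∷ V)  = reflects-map (cong _) (cong Vec.tail) (=ˢ-reflects U V)
=ˢ-reflects (true ∷ U)  (false ∷ V) = ofⁿ λ ()
=ˢ-reflects (false ∷ U) (true ∷ V)  = ofⁿ λ ()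
=ˢ-reflects (false ∷ U) (false ∷ V) = reflects-map (cong _) (cong Vec.tail) (=ˢ-reflects U V)

⊆-reflects : ∀ (U V : Subset N) → Reflects (U ⊆ V) (U ⊆ᵇ V)
⊆-reflects U V = reflects-map (λ h {x} → h x) (λ h x → h)
  (all-reflects ∈-allFin λ x → ∈-reflects x U →-reflects ∈-reflects x V)

nonempty-reflects : ∀ (U : Subset N) → Reflects (Nonempty U) (nonempty U)
nonempty-reflects U = any-reflects ∈-allFin λ x → ∈-reflects x U

∈-∖⁺ : x ∈ˢ X → x ∉ˢ Y → x ∈ˢ X ∖ Y
∈-∖⁺ x∈ x∉ = x∈p∩q⁺ (x∈ , x∉p⇒x∈∁p x∉)

∈-∖⁻ : x ∈ˢ X ∖ Y → x ∈ˢ X × x ∉ˢ Y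
∈-∖⁻ {X = X} x∈ = map₂ x∈∁p⇒x∉p (x∈p∩q⁻ X _ x∈)

∈-⋃⁺ : ∀ {C : List (Subset N)} → U ∈ C → x ∈ˢ U → x ∈ˢ ⋃ C
∈-⋃⁺ (here refl) x∈ = x∈p∪q⁺ (inj₁ x∈)
∈-⋃⁺ (there U∈)  x∈ = x∈p∪q⁺ (inj₂ (∈-⋃⁺ U∈ x∈))

∈-⋃⁻ : ∀ (C : List (Subset N)) → x ∈ˢ ⋃ C → ∃ λ U → U ∈ C × x ∈ˢ U
∈-⋃⁻ []      x∈ = contradiction x∈ ∉⊥
∈-⋃⁻ (U ∷ C) x∈ with x∈p∪q⁻ U (⋃ C) x∈
... | inj₁ x∈U = U , here refl , x∈U
... | inj₂ x∈C = let V , V∈ , x∈V = ∈-⋃⁻ C x∈C in V , there V∈ , x∈V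

⟦_⟧ : {P : Fin N → Set} → (∀ x → Dec (P x)) → Subset N
⟦ P? ⟧ = Vec.tabulate (does ∘ P?)

∈-⟦⟧ : {P : Fin N → Set} (P? : ∀ x → Dec (P x)) → x ∈ˢ ⟦ P? ⟧ ⇔ P x
∈-⟦⟧ {x = x} P? = mk⇔
  (λ x∈ → reflect-T (proof (P? x)) (subst T eq (T-reflect (∈-reflects x ⟦ P? ⟧) x∈)))
  (λ px → reflect-T (∈-reflects x ⟦ P? ⟧) (subst T (sym eq) (T-reflect (proof (P? x)) px)))
  where
  eq : x ∈ᵇ ⟦ P? ⟧ ≡ does (P? x)
  eq = lookup∘tabulate (does ∘ P?) x

-- Families of subsets

Open : Fam N → Subset N → Set
Open F U = T (memF F U)

memF-tabF : (f : Subset n → Bool) (U : Subset n) → memF (tabF f) U ≡ f U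
memF-tabF f []          = refl
memF-tabF f (true ∷ U)  = memF-tabF (f ∘ (true ∷_)) U
memF-tabF f (false ∷ U) = memF-tabF (f ∘ (false ∷_)) U

memF-ext : (F G : Fam n) → (∀ U → memF F U ≡ memF G U) → F ≡ G
memF-ext {zero}  F       G       e = e []
memF-ext {suc n} (F , G) (H , I) e = cong₂ _,_ (memF-ext F H (e ∘ (true ∷_))) (memF-ext G I (e ∘ (false ∷_)))

tabF-⇔ : {P : Subset n → Set} {f : Subset n → Bool} → (∀ U → Reflects (P U) (f U)) →
         ∀ {U} → Open (tabF f) U ⇔ P U
tabF-⇔ {f = f} r {U} = mk⇔
  (λ o → reflect-T (r U) (subst T (memF-tabF f U) o))
  (λ p → subst T (sym (memF-tabF f U)) (T-reflect (r U) p))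

T-ext : ∀ {a b} → (T a → T b) → (T b → T a) → a ≡ b
T-ext {true}  {true}  f g = refl
T-ext {true}  {false} f g = ⊥-elim (f tt)
T-ext {false} {true}  f g = ⊥-elim (g tt)
T-ext {false} {false} f g = refl

Open-ext : {F G : Fam n} → (∀ U → Open F U → Open G U) → (∀ U → Open G U → Open F U) → F ≡ G
Open-ext {F = F} {G} f g = memF-ext F G λ U → T-ext (f U) (g U)

IsTop : Subset N → Fam N → Set
IsTop X 𝒯 = Open 𝒯 ∅ × Open 𝒯 X × (∀ U → Open 𝒯 U → U ⊆ X)
          × (∀ U V → Open 𝒯 U × Open 𝒯 V → Open 𝒯 (U ∪ V) × Open 𝒯 (U ∩ V))

Open-reflects : (F : Fam N) (U : Subset N) → Reflects (Open F U) (memF F U)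
Open-reflects F U = T-reflects (memF F U)

isTop-reflects : ∀ X (𝒯 : Fam N) → Reflects (IsTop X 𝒯) (isTopᵇ X 𝒯)
isTop-reflects X 𝒯 = Open-reflects 𝒯 ∅ ×-reflects Open-reflects 𝒯 X
  ×-reflects all-reflects ∈-allSubsets (λ U → Open-reflects 𝒯 U →-reflects ⊆-reflects U X)
  ×-reflects all-reflects ∈-allSubsets (λ U → all-reflects ∈-allSubsets λ V →
    (Open-reflects 𝒯 U ×-reflects Open-reflects 𝒯 V)
    →-reflects (Open-reflects 𝒯 (U ∪ V) ×-reflects Open-reflects 𝒯 (U ∩ V)))

Le : Fam N → Fin N → Fin N → Set
Le 𝒯 x y = ∀ U → Open 𝒯 U × x ∈ˢ U → y ∈ˢ U

Le-reflects : ∀ (𝒯 : Fam N) x y → Reflects (Le 𝒯 x y) (x ≤⟨ 𝒯 ⟩ y)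
Le-reflects 𝒯 x y = all-reflects ∈-allSubsets λ U →
  (Open-reflects 𝒯 U ×-reflects ∈-reflects x U) →-reflects ∈-reflects y U

Le? : ∀ (𝒯 : Fam N) x y → Dec (Le 𝒯 x y)
Le? 𝒯 x y = _ because Le-reflects 𝒯 x y

Le-refl : (𝒯 : Fam N) → Le 𝒯 x x
Le-refl 𝒯 U = proj₂

Le-trans : ∀ (𝒯 : Fam N) {x y z} → Le 𝒯 x y → Le 𝒯 y z → Le 𝒯 x z
Le-trans 𝒯 p q U (o , x∈) = q U (o , p U (o , x∈))

Sim-reflects : ∀ (𝒯 : Fam N) x y → Reflects (Le 𝒯 x y × Le 𝒯 y x) (x ∼⟨ 𝒯 ⟩ y)
Sim-reflects 𝒯 x y = Le-reflects 𝒯 x y ×-reflects Le-reflects 𝒯 y x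

Lt-reflects : ∀ (𝒯 : Fam N) x y → Reflects (Le 𝒯 x y × ¬ Le 𝒯 y x) (x <⟨ 𝒯 ⟩ y)
Lt-reflects 𝒯 x y = Le-reflects 𝒯 x y ×-reflects ¬-reflects (Le-reflects 𝒯 y x)

∈-opens : (𝒯 : Fam N) → U ∈ opens 𝒯 ⇔ Open 𝒯 U
∈-opens 𝒯 = mk⇔ (proj₂ ∘ to mem) (λ o → from mem (∈-allSubsets _ , o))
  where
  mem : ∀ {U} → U ∈ opens 𝒯 ⇔ (U ∈ allSubsets _ × Open 𝒯 U)
  mem = filterᵇ-∈-⇔ (Open-reflects 𝒯)

opens-unique : (𝒯 : Fam N) → Unique (opens 𝒯)
opens-unique 𝒯 = Uniqueₚ.filter⁺ (T? ∘ memF 𝒯) (allSubsets-unique _)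

ground-≡ : (𝒯 : Fam N) → Open 𝒯 X → (∀ U → Open 𝒯 U → U ⊆ X) → ground 𝒯 ≡ X
ground-≡ 𝒯 oX h = ⊆-antisym
  (λ x∈ → let U , U∈ , x∈U = ∈-⋃⁻ (opens 𝒯) x∈ in h U (to (∈-opens 𝒯) U∈) x∈U)
  (∈-⋃⁺ (from (∈-opens 𝒯) oX))

ground-top : {𝒯 : Fam N} → IsTop X 𝒯 → ground 𝒯 ≡ X
ground-top (_ , oX , h , _) = ground-≡ _ oX h

-- Restriction

Open-∣ : (𝒯 : Fam N) → ∀ {Y W} → Open (𝒯 ∣ Y) W ⇔ (∃ λ Z → Open 𝒯 Z × Z ∩ Y ≡ W)
Open-∣ 𝒯 {Y} = tabF-⇔ λ W → any-reflects ∈-allSubsets λ Z → Open-reflects 𝒯 Z ×-reflects =ˢ-reflects (Z ∩ Y) W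

ground-∣ : {𝒯 : Fam N} → IsTop X 𝒯 → Y ⊆ X → ground (𝒯 ∣ Y) ≡ Y
ground-∣ {X = X} {Y = Y} {𝒯 = 𝒯} (_ , oX , _) Y⊆X = ground-≡ (𝒯 ∣ Y)
  (from (Open-∣ 𝒯) (X , oX , ⊆-antisym (proj₂ ∘ x∈p∩q⁻ X Y) (λ x∈ → x∈p∩q⁺ (Y⊆X x∈ , x∈))))
  λ U o x∈ → let Z , _ , e = to (Open-∣ 𝒯) o in proj₂ (x∈p∩q⁻ Z Y (subst (_ ∈ˢ_) (sym e) x∈))

Le-∣ : (𝒯 : Fam N) → x ∈ˢ Y → y ∈ˢ Y → Le (𝒯 ∣ Y) x y ⇔ Le 𝒯 x y
Le-∣ {x = x} {Y = Y} {y = y} 𝒯 x∈Y y∈Y = mk⇔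
  (λ le U (o , x∈U) → proj₁ (x∈p∩q⁻ U Y (le (U ∩ Y) (from (Open-∣ 𝒯) (U , o , refl) , x∈p∩q⁺ (x∈U , x∈Y)))))
  λ le U (o , x∈U) → let Z , oZ , e = to (Open-∣ 𝒯) o in
    subst (y ∈ˢ_) e (x∈p∩q⁺ (le Z (oZ , proj₁ (x∈p∩q⁻ Z Y (subst (x ∈ˢ_) (sym e) x∈U))) , y∈Y))

-- In a finite topology the sets closed under ≤ are unions of minimal neighbourhoods, hence open.

module _ {X : Subset N} {𝒯 : Fam N} (top : IsTop X 𝒯) where
  private
    o∅ = proj₁ top
    oX = proj₁ (proj₂ top)
    o⊆ = proj₁ (proj₂ (proj₂ top))
    o∪∩ = proj₂ (proj₂ (proj₂ top))

  Le-∈ : x ∈ˢ X → Le 𝒯 x y → y ∈ˢ X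
  Le-∈ x∈ le = le X (oX , x∈)

  nbhd : Fin N → Subset N
  nbhd x = foldr _∩_ X (filter (x ∈?_) (opens 𝒯))

  foldr-∩-open : ∀ {Us} → (∀ {U} → U ∈ Us → Open 𝒯 U) → Open 𝒯 (foldr _∩_ X Us)
  foldr-∩-open {[]}     h = oX
  foldr-∩-open {U ∷ Us} h = proj₂ (o∪∩ U _ (h (here refl) , foldr-∩-open (h ∘ there)))

  foldr-∩⁺ : ∀ {Us} → x ∈ˢ X → (∀ {U} → U ∈ Us → x ∈ˢ U) → x ∈ˢ foldr _∩_ X Us
  foldr-∩⁺ {Us = []}     x∈ h = x∈
  foldr-∩⁺ {Us = U ∷ Us} x∈ h = x∈p∩q⁺ (h (here refl) , foldr-∩⁺ x∈ (h ∘ there))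

  foldr-∩⁻ : ∀ {Us} → U ∈ Us → foldr _∩_ X Us ⊆ U
  foldr-∩⁻ (here refl) x∈ = proj₁ (x∈p∩q⁻ _ _ x∈)
  foldr-∩⁻ (there U∈)  x∈ = foldr-∩⁻ U∈ (proj₂ (x∈p∩q⁻ _ _ x∈))

  nbhd-open : ∀ x → Open 𝒯 (nbhd x)
  nbhd-open x = foldr-∩-open λ U∈ → to (∈-opens 𝒯) (proj₁ (∈-filter⁻ (x ∈?_) U∈))

  ∈-nbhd : x ∈ˢ X → x ∈ˢ nbhd x
  ∈-nbhd {x = x} x∈ = foldr-∩⁺ x∈ λ U∈ → proj₂ (∈-filter⁻ (x ∈?_) {xs = opens 𝒯} U∈)

  nbhd⇒Le : y ∈ˢ nbhd x → Le 𝒯 x y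
  nbhd⇒Le {x = x} y∈ U (o , x∈U) = foldr-∩⁻ (∈-filter⁺ (x ∈?_) (from (∈-opens 𝒯) o) x∈U) y∈

  hull : Subset N → Subset N
  hull W = ⋃ (map nbhd (filter (_∈? W) (allFin N)))

  ⋃-open : ∀ {Us} → (∀ {U} → U ∈ Us → Open 𝒯 U) → Open 𝒯 (⋃ Us)
  ⋃-open {[]}     h = o∅
  ⋃-open {U ∷ Us} h = proj₁ (o∪∩ U _ (h (here refl) , ⋃-open (h ∘ there)))

  hull-open : ∀ W → Open 𝒯 (hull W)
  hull-open W = ⋃-open {map nbhd (filter (_∈? W) (allFin N))} λ U∈ → let x , _ , e = ∈-map⁻ nbhd U∈ in subst (Open 𝒯) (sym e) (nbhd-open x)

  ⊆-hull : W ⊆ X → W ⊆ hull W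
  ⊆-hull {W = W} W⊆X {x} x∈ = ∈-⋃⁺ (∈-map⁺ nbhd (∈-filter⁺ (_∈? W) (∈-allFin x) x∈)) (∈-nbhd (W⊆X x∈))

  ∈-hull⁻ : y ∈ˢ hull W → ∃ λ x → x ∈ˢ W × Le 𝒯 x y
  ∈-hull⁻ {W = W} y∈ with ∈-⋃⁻ (map nbhd (filter (_∈? W) (allFin N))) y∈
  ... | U , U∈ , y∈U with ∈-map⁻ nbhd U∈
  ... | x , x∈ , refl = x , proj₂ (∈-filter⁻ (_∈? W) {xs = allFin N} x∈) , nbhd⇒Le y∈U

  -- The up-closure `hull W` may leave `Y`, but its trace on `Y` is exactly `W`.
  closed⇒Open-∣ : Y ⊆ X → W ⊆ Y → (∀ {x y} → x ∈ˢ W → y ∈ˢ Y → Le 𝒯 x y → y ∈ˢ W) → Open (𝒯 ∣ Y) W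
  closed⇒Open-∣ {Y = Y} {W = W} Y⊆X W⊆Y cl = from (Open-∣ 𝒯) (hull W , hull-open W , ⊆-antisym
    (λ y∈ → let y∈h , y∈Y = x∈p∩q⁻ (hull W) Y y∈
                x , x∈W , le = ∈-hull⁻ y∈h in cl x∈W y∈Y le)
    λ y∈ → x∈p∩q⁺ (⊆-hull (Y⊆X ∘ W⊆Y) y∈ , W⊆Y y∈))

  closed⇒Open : W ⊆ X → (∀ {x y} → x ∈ˢ W → y ∈ˢ X → Le 𝒯 x y → y ∈ˢ W) → Open 𝒯 W
  closed⇒Open {W = W} W⊆X cl = subst (Open 𝒯) (⊆-antisym
    (λ y∈ → let x , x∈W , le = ∈-hull⁻ y∈ in cl x∈W (Le-∈ (W⊆X x∈W) le) le) (⊆-hull W⊆X)) (hull-open W)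

  Open-∣-closed : Open (𝒯 ∣ Y) W → x ∈ˢ W → y ∈ˢ Y → Le 𝒯 x y → y ∈ˢ W
  Open-∣-closed {Y = Y} {x = x} {y = y} o x∈ y∈ le = let Z , oZ , e = to (Open-∣ 𝒯) o in
    subst (y ∈ˢ_) e (x∈p∩q⁺ (le Z (oZ , proj₁ (x∈p∩q⁻ Z Y (subst (x ∈ˢ_) (sym e) x∈))) , y∈))

Open-∣-⊆ : (𝒯 : Fam N) → Open (𝒯 ∣ Y) W → W ⊆ Y
Open-∣-⊆ {Y = Y} 𝒯 o x∈ = let Z , _ , e = to (Open-∣ 𝒯) o in proj₂ (x∈p∩q⁻ Z Y (subst (_ ∈ˢ_) (sym e) x∈))

-- Opens are the up-sets of the preorder, so the smaller preorder has more of them; inclusions of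
-- topologies are proved this way, with the direction reversed.
∣-⊆-by-Le : {𝒯 𝒯' : Fam N} → IsTop X 𝒯 → IsTop X 𝒯' → Y ⊆ X →
  (∀ {x y} → x ∈ˢ Y → y ∈ˢ Y → Le 𝒯' x y → Le 𝒯 x y) → ∀ U → Open (𝒯 ∣ Y) U → Open (𝒯' ∣ Y) U
∣-⊆-by-Le {𝒯 = 𝒯} t t' Y⊆X h U o = closed⇒Open-∣ t' Y⊆X (Open-∣-⊆ 𝒯 o)
  λ x∈ y∈ le → Open-∣-closed t o x∈ y∈ (h (Open-∣-⊆ 𝒯 o x∈) y∈ le)

⊆-by-Le : {𝒯 𝒯' : Fam N} → IsTop X 𝒯 → IsTop X 𝒯' →
  (∀ {x y} → x ∈ˢ X → y ∈ˢ X → Le 𝒯' x y → Le 𝒯 x y) → ∀ U → Open 𝒯 U → Open 𝒯' U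
⊆-by-Le {𝒯 = 𝒯} t@(_ , _ , h⊆ , _) t' h U o = closed⇒Open t' (h⊆ U o)
  λ x∈ y∈ le → h (h⊆ U o x∈) y∈ le U (o , x∈)

-- Topologies from relations

Open-topOfQO : ∀ (X : Subset N) {R : Fin N → Fin N → Set} {Q} → (∀ x y → Reflects (R x y) (Q x y)) →
  ∀ {U} → Open (topOfQO X Q) U ⇔ (U ⊆ X × (∀ x y → x ∈ˢ U × R x y → y ∈ˢ U))
Open-topOfQO X r = tabF-⇔ λ U → ⊆-reflects U X ×-reflects all-reflects ∈-allFin λ x → all-reflects ∈-allFin λ y →
  (∈-reflects x U ×-reflects r x y) →-reflects ∈-reflects y U

-- `F` is described by its opens being the `R`-closed sets, where `R` may be a preorder or just a
-- generating relation. Topologies of preorders and quotient topologies are thus treated alike.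
module _ (X : Subset N) {R : Fin N → Fin N → Set} (F : Fam N)
  (F-⇔ : ∀ {U} → Open F U ⇔ (U ⊆ X × (∀ x y → x ∈ˢ U × R x y → y ∈ˢ U)))
  (R-∈ : ∀ {x y} → R x y → y ∈ˢ X) where

  closed-isTop : IsTop X F
  closed-isTop = from F-⇔ (⊥⊆ , λ { _ _ (x∈ , _) → contradiction x∈ ∉⊥ })
    , from F-⇔ (id , λ { _ _ (_ , r) → R-∈ r })
    , (λ U o → proj₁ (to F-⇔ o))
    , λ { U V (oU , oV) →
        let U⊆ , clU = to F-⇔ oU
            V⊆ , clV = to F-⇔ oV
        in from F-⇔ ((λ x∈ → Sum.[_,_] U⊆ V⊆ (x∈p∪q⁻ U V x∈))
             , λ { x y (x∈ , r) → x∈p∪q⁺ (Sum.map (λ x∈ → clU x y (x∈ , r)) (λ x∈ → clV x y (x∈ , r)) (x∈p∪q⁻ U V x∈)) })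
         , from F-⇔ ((λ x∈ → U⊆ (proj₁ (x∈p∩q⁻ U V x∈)))
             , λ { x y (x∈ , r) → let x∈U , x∈V = x∈p∩q⁻ U V x∈ in x∈p∩q⁺ (clU x y (x∈U , r) , clV x y (x∈V , r)) }) }

  R⇒Le : ∀ {x y} → R x y → Le F x y
  R⇒Le {x} {y} r U (o , x∈) = proj₂ (to F-⇔ o) x y (x∈ , r)

  -- Le F is the least preorder on X containing R.
  Le-least : {S : Fin N → Set} (S? : ∀ z → Dec (S z)) → ∀ {x y} → x ∈ˢ X → S x →
    (∀ {z w} → z ∈ˢ X → S z → R z w → S w) → Le F x y → S y
  -- The points of `X` satisfying `S` form an `R`-closed, hence open, set containing `x`; so it
  -- contains everything above `x`.
  Le-least S? {x} x∈ sx step le = proj₂ (to ∈S (le S-set (from F-⇔ ((proj₁ ∘ to ∈S) , cl) , from ∈S (x∈ , sx))))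
    where
    P? = λ z → (z ∈? X) ×-dec S? z
    S-set = ⟦ P? ⟧
    ∈S : ∀ {z} → z ∈ˢ S-set ⇔ _
    ∈S = ∈-⟦⟧ P?
    cl : ∀ z w → z ∈ˢ S-set × R z w → w ∈ˢ S-set
    cl z w (z∈ , r) = let z∈X , sz = to ∈S z∈ in from ∈S (R-∈ r , step z∈X sz r)

-- `reach n X R k` is the auxiliary function in the definition of `transClos`, which has no name
-- outside that definition: the metavariable is solved by matching the k-th step against it, after
-- n has been made independent of k by abstracting over `suc k`.

mutual
  reach : ∀ n → Subset n → (Fin n → Fin n → Bool) → ℕ → Fin n → Fin n → Bool
  reach = _

  transClos-suc : ∀ k (X : Subset (suc k)) R x y → transClos X R x y ≡
    (reach (suc k) X R k x y ∨ any (λ z → (z ∈ᵇ X) ∧ reach (suc k) X R k x z ∧ R z y) (allFin (suc k)))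
  transClos-suc k with suc k | Fin.zero {k} | tabulate {n = k} Fin.suc | _∨_
  ... | _ | _ | _ | _ = λ X R x y → refl

module _ (X : Subset N) {R : Fin N → Fin N → Set} {Q : Fin N → Fin N → Bool} (r : ∀ x y → Reflects (R x y) (Q x y)) where

  data Path : ℕ → Fin N → Fin N → Set where
    edge : ∀ {x y} → R x y → Path 0 x y
    stay : ∀ {k x y} → Path k x y → Path (suc k) x y
    snoc : ∀ {k x y z} → z ∈ˢ X → Path k x z → R z y → Path (suc k) x y

  reach-reflects : ∀ k x y → Reflects (Path k x y) (reach N X Q k x y)
  reach-reflects zero x y = reflects-map edge (λ { (edge r) → r }) (r x y)
  reach-reflects (suc k) x y = reflects-map
    (λ { (inj₁ p) → stay p ; (inj₂ (z , z∈ , p , s)) → snoc z∈ p s })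
    (λ { (stay p) → inj₁ p ; (snoc z∈ p s) → inj₂ (_ , z∈ , p , s) })
    (reach-reflects k x y ⊎-reflects any-reflects ∈-allFin λ z →
      ∈-reflects z X ×-reflects (reach-reflects k x z ×-reflects r z y))

  edge* : ∀ {x y} → R x y → ∀ k → Path k x y
  edge* s zero    = edge s
  edge* s (suc k) = stay (edge* s k)

  Path-closed : ∀ {k x y} → (∀ x y → x ∈ˢ U × R x y → y ∈ˢ U) → x ∈ˢ U → Path k x y → y ∈ˢ U
  Path-closed cl x∈ (edge s)     = cl _ _ (x∈ , s)
  Path-closed cl x∈ (stay p)     = Path-closed cl x∈ p
  Path-closed cl x∈ (snoc _ p s) = cl _ _ (Path-closed cl x∈ p , s)

  -- A set closed under `R` is closed under paths of any length, and edges are paths. From here on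
  -- only the generating relation of a quotient is used, and no bound on the length of paths has to
  -- be proved.
  Open-transClos : ∀ {U} → Open (topOfQO X (transClos X Q)) U ⇔ (U ⊆ X × (∀ x y → x ∈ˢ U × R x y → y ∈ˢ U))
  Open-transClos {U} = mk⇔ fwd bwd
    where
    Closed : (Fin N → Fin N → Set) → Set
    Closed S = U ⊆ X × (∀ x y → x ∈ˢ U × S x y → y ∈ˢ U)
    open-reach : Open (topOfQO X (transClos X Q)) U ⇔ Closed (Path N)
    open-reach = Open-topOfQO X (reach-reflects N)
    fwd : Open (topOfQO X (transClos X Q)) U → Closed R
    fwd o = proj₁ (to open-reach o) , λ { x y (x∈ , s) → proj₂ (to open-reach o) x y (x∈ , edge* s N) }
    bwd : Closed R → Open (topOfQO X (transClos X Q)) U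
    bwd (U⊆ , cl) = from open-reach (U⊆ , λ { x y (x∈ , p) → Path-closed cl x∈ p })

-- Set compositions

-- Removing the first block from the index encodes disjointness and covering at once and makes
-- induction on the list available; `isSC-reflects` identifies this with the Boolean definition.
data Comp {N : ℕ} : Subset N → SC N → Set where
  nil  : (∀ x → x ∉ˢ X) → Comp X []
  cons : Nonempty B → B ⊆ X → Comp (X ∖ B) C → Comp X (B ∷ C)

Comp-resp : X ⊆ Y → Y ⊆ X → Comp X C → Comp Y C
Comp-resp X⊆Y Y⊆X = subst (λ Z → Comp Z _) (⊆-antisym X⊆Y Y⊆X)

blocksAt : Fin N → SC N → SC N
blocksAt x = filterᵇ (λ B → x ∈ᵇ B)

blocksAt-∈ : x ∈ˢ B → blocksAt x (B ∷ C) ≡ B ∷ blocksAt x C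
blocksAt-∈ {x = x} {B = B} x∈ = filter-accept (T? ∘ (x ∈ᵇ_)) (T-reflect (∈-reflects x B) x∈)

blocksAt-∉ : x ∉ˢ B → blocksAt x (B ∷ C) ≡ blocksAt x C
blocksAt-∉ {x = x} {B = B} {C = C} x∉ = filter-reject (T? ∘ (x ∈ᵇ_)) {x = B} {xs = C} (x∉ ∘ reflect-T (∈-reflects x B))

OnceIn : Subset N → SC N → Fin N → Set
OnceIn X C x = (x ∈ˢ X → ∃ λ B → blocksAt x C ≡ B ∷ []) × (x ∉ˢ X → blocksAt x C ≡ [])

Comp⇒OnceIn : Comp X C → ∀ x → OnceIn X C x
Comp⇒OnceIn (nil ∉X) x = (λ x∈ → contradiction x∈ (∉X x)) , λ _ → refl
Comp⇒OnceIn {X = X} (cons {B = B} _ B⊆X c) x with x ∈? B | Comp⇒OnceIn c x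
... | yes x∈B | _ , none = (λ _ → B , trans (blocksAt-∈ x∈B) (cong (B ∷_) (none λ x∈ → proj₂ (∈-∖⁻ {X = X} x∈) x∈B)))
                         , λ x∉X → contradiction (B⊆X x∈B) x∉X
... | no x∉B  | one , none = (λ x∈X → map₂ (trans (blocksAt-∉ x∉B)) (one (∈-∖⁺ x∈X x∉B)))
                           , λ x∉X → trans (blocksAt-∉ x∉B) (none λ x∈ → x∉X (proj₁ (∈-∖⁻ {X = X} x∈)))

OnceIn⇒Comp : All Nonempty C → (∀ x → OnceIn X C x) → Comp X C
OnceIn⇒Comp {C = []} [] o = nil λ x x∈ → nil≢ (proj₁ (o x) x∈)
  where
  nil≢ : ¬ (∃ λ B → [] ≡ B ∷ [])
  nil≢ (_ , ())
OnceIn⇒Comp {N} {C = B ∷ C} {X = X} (ne ∷ nes) o = cons ne B⊆X (OnceIn⇒Comp nes tail)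
  where
  B⊆X : B ⊆ X
  B⊆X {x} x∈B with x ∈? X
  ... | yes x∈X = x∈X
  ... | no x∉X with trans (sym (blocksAt-∈ x∈B)) (proj₂ (o x) x∉X)
  ...   | ()
  tail : ∀ x → OnceIn (X ∖ B) C x
  tail x with x ∈? B
  ... | yes x∈B = (λ x∈ → contradiction x∈B (proj₂ (∈-∖⁻ {X = X} x∈)))
      , λ _ → ∷-injectiveʳ (trans (sym (blocksAt-∈ x∈B)) (proj₂ (proj₁ (o x) (B⊆X x∈B))))
  ... | no x∉B = (λ x∈ → map₂ (trans (sym (blocksAt-∉ x∉B))) (proj₁ (o x) (proj₁ (∈-∖⁻ {X = X} x∈))))
      , λ x∉ → trans (sym (blocksAt-∉ x∉B)) (proj₂ (o x) λ x∈X → x∉ (∈-∖⁺ x∈X x∉B))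

Comp⇒nonempty : Comp X C → All Nonempty C
Comp⇒nonempty (nil _)      = []
Comp⇒nonempty (cons ne _ c) = ne ∷ Comp⇒nonempty c

-- The pointwise test in `isSCᵇ` uses helpers local to that definition. A failing point can be
-- extracted with the predicate left to unification; a case split on membership and on `blocksAt`
-- then lets the test compute.
all-counterexample : ∀ {A : Set} (p : A → Bool) xs → ¬ T (all p xs) → ∃ λ x → ¬ T (p x)
all-counterexample p []       ¬t = contradiction tt ¬t
all-counterexample p (x ∷ xs) ¬t with p x in eq
... | true  = all-counterexample p xs ¬t
... | false = x , λ t → subst T eq t

all-nonempty-reflects : (C : SC N) → Reflects (∀ B → B ∈ C → Nonempty B) (all nonempty C)
all-nonempty-reflects = all-∈-reflects nonempty-reflects

isSC⇒Comp : (X : Subset N) (C : SC N) → T (isSCᵇ X C) → Comp X C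
isSC⇒Comp {N} X C t = OnceIn⇒Comp (All.tabulate (reflect-T (all-nonempty-reflects C) (proj₁ ts) _)) once
  where
  ts = to (T-∧ {all nonempty C}) t
  once : ∀ x → OnceIn X C x
  once x with x ∈ᵇ X | ∈-reflects x X | blocksAt x C
            | reflect-T (all-reflects {xs = allFin N} ∈-allFin (λ x → T-reflects _)) (proj₂ ts) x
  ... | true  | ofʸ x∈ | B ∷ [] | _ = (λ _ → B , refl) , λ x∉ → contradiction x∈ x∉
  ... | false | ofⁿ x∉ | []     | _ = (λ x∈ → contradiction x∈ x∉) , λ _ → refl

Comp⇒isSC : (X : Subset N) (C : SC N) → Comp X C → T (isSCᵇ X C)
Comp⇒isSC {N} X C c with T? (isSCᵇ X C)
... | yes t = t
... | no ¬t with all-counterexample _ (allFin N) (λ t → ¬t (from (T-∧ {all nonempty C})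
                   (T-reflect (all-nonempty-reflects C) (λ _ → All.lookup (Comp⇒nonempty c)) , t)))
... | x , ¬p with x ∈ᵇ X | ∈-reflects x X | blocksAt x C | Comp⇒OnceIn c x | ¬p
... | true  | ofʸ x∈ | []        | one , _  | _  = contradiction (proj₂ (one x∈)) λ ()
... | true  | ofʸ x∈ | _ ∷ []    | _        | ¬p = contradiction tt ¬p
... | true  | ofʸ x∈ | _ ∷ _ ∷ _ | one , _  | _  = contradiction (proj₂ (one x∈)) λ ()
... | false | ofⁿ x∉ | []        | _        | ¬p = contradiction tt ¬p
... | false | ofⁿ x∉ | _ ∷ _     | _ , none | _  = contradiction (none x∉) λ ()

isSC-reflects : (X : Subset N) (C : SC N) → Reflects (Comp X C) (isSCᵇ X C)
isSC-reflects X C = reflects-map (isSC⇒Comp X C) (Comp⇒isSC X C) (T-reflects _)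

-- Each block uses up at least one point. Hence a set composition has at most `N` blocks and is
-- found by `listsUpTo N`.
length-Comp : Comp X C → length C ≤ size X
length-Comp (nil _) = z≤n
length-Comp {X = X} (cons (x , x∈) B⊆X c) = ≤-trans (s≤s (length-Comp c))
  (p⊂q⇒∣p∣<∣q∣ ((λ y∈ → proj₁ (∈-∖⁻ {X = X} y∈)) , x , B⊆X x∈ , λ x∈' → proj₂ (∈-∖⁻ {X = X} x∈') x∈))

∈-allSC : (X : Subset N) → C ∈ allSC X ⇔ Comp X C
∈-allSC {N} X = mk⇔ (λ C∈ → proj₂ (to mem C∈))
  λ c → from mem (∈-listsUpTo N _ (≤-trans (length-Comp c) (∣p∣≤n X)) , c)
  where
  mem : ∀ {C} → C ∈ allSC X ⇔ (C ∈ listsUpTo N × Comp X C)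
  mem = filterᵇ-∈-⇔ (isSC-reflects X)

allSC-unique : (X : Subset N) → Unique (allSC X)
allSC-unique {N} X = Uniqueₚ.filter⁺ (T? ∘ isSCᵇ X) (listsUpTo-unique N)

⋃-Comp : Comp X C → ⋃ C ≡ X
⋃-Comp {X = X} (nil ∉X) = ⊆-antisym ⊥⊆ λ x∈ → contradiction x∈ (∉X _)
⋃-Comp {X = X} (cons {B = B} {C = C} _ B⊆X c) = ⊆-antisym fwd bwd
  where
  fwd : ⋃ (B ∷ C) ⊆ X
  fwd x∈ with x∈p∪q⁻ B (⋃ C) x∈
  ... | inj₁ x∈B = B⊆X x∈B
  ... | inj₂ x∈C = proj₁ (∈-∖⁻ {X = X} (subst (_ ∈ˢ_) (⋃-Comp c) x∈C))
  bwd : X ⊆ ⋃ (B ∷ C)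
  bwd {x} x∈ with x ∈? B
  ... | yes x∈B = x∈p∪q⁺ (inj₁ x∈B)
  ... | no x∉B  = x∈p∪q⁺ (inj₂ (subst (_ ∈ˢ_) (sym (⋃-Comp c)) (∈-∖⁺ x∈ x∉B)))

Comp-++⁺ : Comp Y C → Y ⊆ X → Comp (X ∖ Y) D → Comp X (C ++ D)
Comp-++⁺ {X = X} (nil ∉Y) _ d = Comp-resp (λ x∈ → proj₁ (∈-∖⁻ {X = X} x∈)) (λ x∈ → ∈-∖⁺ x∈ (∉Y _)) d
Comp-++⁺ {Y = Y} {X = X} (cons {B = B} ne B⊆Y c) Y⊆X d = cons ne (λ x∈ → Y⊆X (B⊆Y x∈))
  (Comp-++⁺ c (λ x∈ → let x∈Y , x∉B = ∈-∖⁻ {X = Y} x∈ in ∈-∖⁺ (Y⊆X x∈Y) x∉B)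
    (Comp-resp
      (λ x∈ → let x∈X , x∉Y = ∈-∖⁻ {X = X} x∈ in
         ∈-∖⁺ (∈-∖⁺ x∈X (λ x∈B → x∉Y (B⊆Y x∈B))) λ x∈ → x∉Y (proj₁ (∈-∖⁻ {X = Y} x∈)))
      (λ x∈ → let x∈' , x∉ = ∈-∖⁻ {X = X ∖ B} x∈
                  x∈X , x∉B = ∈-∖⁻ {X = X} x∈' in
         ∈-∖⁺ x∈X λ x∈Y → x∉ (∈-∖⁺ x∈Y x∉B)) d))

Comp-++⁻ : ∀ (C : SC N) {D} → Comp X (C ++ D) → Comp (⋃ C) C × ⋃ C ⊆ X × Comp (X ∖ ⋃ C) D
Comp-++⁻ []      d = nil (λ _ → ∉⊥) , ⊥⊆ , Comp-resp (λ x∈ → ∈-∖⁺ x∈ ∉⊥) (λ x∈ → proj₁ (∈-∖⁻ x∈)) d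
Comp-++⁻ {X = X} (B ∷ C) {D} (cons ne B⊆X cd) with Comp-++⁻ C cd
... | c , C⊆ , d = (cons ne (λ x∈ → x∈p∪q⁺ (inj₁ x∈)) (Comp-resp fwd bwd c)) , ⊆X , Comp-resp fwd' bwd' d
  where
  fwd : ⋃ C ⊆ ⋃ (B ∷ C) ∖ B
  fwd x∈ = ∈-∖⁺ (x∈p∪q⁺ (inj₂ x∈)) (proj₂ (∈-∖⁻ {X = X} (C⊆ x∈)))
  bwd : ⋃ (B ∷ C) ∖ B ⊆ ⋃ C
  bwd x∈ with ∈-∖⁻ {X = ⋃ (B ∷ C)} x∈
  ... | x∈' , x∉B with x∈p∪q⁻ B (⋃ C) x∈'
  ...   | inj₁ x∈B = contradiction x∈B x∉B
  ...   | inj₂ x∈C = x∈C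
  ⊆X : ⋃ (B ∷ C) ⊆ X
  ⊆X x∈ with x∈p∪q⁻ B (⋃ C) x∈
  ... | inj₁ x∈B = B⊆X x∈B
  ... | inj₂ x∈C = proj₁ (∈-∖⁻ {X = X} (C⊆ x∈C))
  fwd' : (X ∖ B) ∖ ⋃ C ⊆ X ∖ ⋃ (B ∷ C)
  fwd' x∈ with ∈-∖⁻ {X = X ∖ B} x∈
  ... | x∈' , x∉C with ∈-∖⁻ {X = X} x∈'
  ...   | x∈X , x∉B = ∈-∖⁺ x∈X λ x∈ → ∉∪ x∉B x∉C (x∈p∪q⁻ B (⋃ C) x∈)
    where
    ∉∪ : ∀ {x} → x ∉ˢ B → x ∉ˢ ⋃ C → ¬ (x ∈ˢ B ⊎ x ∈ˢ ⋃ C)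
    ∉∪ p q (inj₁ r) = p r
    ∉∪ p q (inj₂ r) = q r
  bwd' : X ∖ ⋃ (B ∷ C) ⊆ (X ∖ B) ∖ ⋃ C
  bwd' x∈ = let x∈X , x∉ = ∈-∖⁻ {X = X} x∈ in
    ∈-∖⁺ (∈-∖⁺ x∈X (λ x∈B → x∉ (x∈p∪q⁺ (inj₁ x∈B)))) λ x∈C → x∉ (x∈p∪q⁺ (inj₂ x∈C))

-- The total preorder of a set composition

-- A point outside every block gets `length C`, behind all blocks. This default survives
-- restriction, so `restrict-≼` can compare any two points of `Y`.
pos : SC N → Fin N → ℕ
pos []      x = 0
pos (B ∷ C) x = if x ∈ᵇ B then 0 else suc (pos C x)

pos-∈ : ∀ (B : Subset N) C → x ∈ˢ B → pos (B ∷ C) x ≡ 0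
pos-∈ {x = x} B C x∈ with x ∈ᵇ B | ∈-reflects x B
... | true  | _      = refl
... | false | ofⁿ x∉ = contradiction x∈ x∉

pos-∉ : ∀ (B : Subset N) C → x ∉ˢ B → pos (B ∷ C) x ≡ suc (pos C x)
pos-∉ {x = x} B C x∉ with x ∈ᵇ B | ∈-reflects x B
... | true  | ofʸ x∈ = contradiction x∈ x∉
... | false | _      = refl

infix 4 _⊢_≼_
_⊢_≼_ : SC N → Fin N → Fin N → Set
C ⊢ x ≼ y = pos C x ≤ pos C y

≼-here : ∀ (B : Subset N) C → x ∈ˢ B → B ∷ C ⊢ x ≼ y
≼-here {y = y} B C x∈ = subst (_≤ pos (B ∷ C) y) (sym (pos-∈ B C x∈)) z≤n

≼-there : ∀ (B : Subset N) C → x ∉ˢ B → y ∉ˢ B → B ∷ C ⊢ x ≼ y ⇔ C ⊢ x ≼ y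
≼-there B C x∉ y∉ = mk⇔
  (λ le → s≤s⁻¹ (subst₂ _≤_ (pos-∉ B C x∉) (pos-∉ B C y∉) le))
  (λ le → subst₂ _≤_ (sym (pos-∉ B C x∉)) (sym (pos-∉ B C y∉)) (s≤s le))

≼-not-here : ∀ (B : Subset N) C → x ∉ˢ B → y ∈ˢ B → ¬ (B ∷ C ⊢ x ≼ y)
≼-not-here B C x∉ y∈ le with subst₂ _≤_ (pos-∉ B C x∉) (pos-∈ B C y∈) le
... | ()

pos-++ˡ : ∀ (C D : SC N) → x ∈ˢ ⋃ C → pos (C ++ D) x ≡ pos C x × pos C x < length C
pos-++ˡ []      D x∈ = contradiction x∈ ∉⊥
pos-++ˡ {x = x} (B ∷ C) D x∈ with x ∈? B | x∈p∪q⁻ B (⋃ C) x∈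
... | yes x∈B | _ = trans (pos-∈ B (C ++ D) x∈B) (sym (pos-∈ B C x∈B)) , subst (_< length (B ∷ C)) (sym (pos-∈ B C x∈B)) (s≤s z≤n)
... | no x∉B  | inj₁ x∈B = contradiction x∈B x∉B
... | no x∉B  | inj₂ x∈C = let e , l = pos-++ˡ C D x∈C in
      trans (pos-∉ B (C ++ D) x∉B) (trans (cong suc e) (sym (pos-∉ B C x∉B)))
    , subst (_< length (B ∷ C)) (sym (pos-∉ B C x∉B)) (s≤s l)

pos-++ʳ : ∀ (C D : SC N) → x ∉ˢ ⋃ C → pos (C ++ D) x ≡ length C ℕ.+ pos D x
pos-++ʳ []      D x∉ = refl
pos-++ʳ (B ∷ C) D x∉ = trans (pos-∉ B (C ++ D) λ x∈ → x∉ (x∈p∪q⁺ (inj₁ x∈)))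
  (cong suc (pos-++ʳ C D λ x∈ → x∉ (x∈p∪q⁺ (inj₂ x∈))))

module _ (C D : SC N) where

  ≼-++ˡˡ : x ∈ˢ ⋃ C → y ∈ˢ ⋃ C → C ++ D ⊢ x ≼ y ⇔ C ⊢ x ≼ y
  ≼-++ˡˡ x∈ y∈ = mk⇔ (subst₂ _≤_ ex ey) (subst₂ _≤_ (sym ex) (sym ey))
    where
    ex = proj₁ (pos-++ˡ C D x∈)
    ey = proj₁ (pos-++ˡ C D y∈)

  pos-< : x ∈ˢ ⋃ C → y ∉ˢ ⋃ C → pos (C ++ D) x < pos (C ++ D) y
  pos-< x∈ y∉ = let e , l = pos-++ˡ C D x∈ in
    subst₂ _<_ (sym e) (sym (pos-++ʳ C D y∉)) (≤-trans l (m≤m+n _ _))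

  ≼-++ʳʳ : x ∉ˢ ⋃ C → y ∉ˢ ⋃ C → C ++ D ⊢ x ≼ y ⇔ D ⊢ x ≼ y
  ≼-++ʳʳ x∉ y∉ = mk⇔
    (λ le → +-cancelˡ-≤ (length C) _ _ (subst₂ _≤_ ex ey le))
    (λ le → subst₂ _≤_ (sym ex) (sym ey) (+-monoʳ-≤ (length C) le))
    where
    ex = pos-++ʳ C D x∉
    ey = pos-++ʳ C D y∉

-- The first block is the set of least points of the preorder, hence determined by it; the rest
-- follows by induction on the remaining points.
pos-order-unique : Comp X C → Comp X D → (∀ {x y} → x ∈ˢ X → y ∈ˢ X → C ⊢ x ≼ y ⇔ D ⊢ x ≼ y) → C ≡ D
pos-order-unique (nil _) (nil _) e = refl
pos-order-unique (nil ∉X) (cons (x , x∈) B⊆ _) e = contradiction (B⊆ x∈) (∉X x)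
pos-order-unique (cons (x , x∈) B⊆ _) (nil ∉X) e = contradiction (B⊆ x∈) (∉X x)
pos-order-unique {X = X} (cons {B = A} {C = C} neA A⊆ c) (cons {B = B} {C = D} neB B⊆ d) e =
  cong₂ _∷_ A≡B (pos-order-unique c (subst (λ Z → Comp (X ∖ Z) D) (sym A≡B) d) tails)
  where
  A⊆B : A ⊆ B
  A⊆B {x} x∈A with x ∈? B
  ... | yes x∈B = x∈B
  ... | no x∉B  = let y , y∈B = neB in
    contradiction (to (e (A⊆ x∈A) (B⊆ y∈B)) (≼-here A C x∈A)) (≼-not-here B D x∉B y∈B)
  B⊆A : B ⊆ A
  B⊆A {x} x∈B with x ∈? A
  ... | yes x∈A = x∈A
  ... | no x∉A  = let y , y∈A = neA in
    contradiction (from (e (B⊆ x∈B) (A⊆ y∈A)) (≼-here B D x∈B)) (≼-not-here A C x∉A y∈A)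
  A≡B : A ≡ B
  A≡B = ⊆-antisym A⊆B B⊆A
  tails : ∀ {x y} → x ∈ˢ X ∖ A → y ∈ˢ X ∖ A → C ⊢ x ≼ y ⇔ D ⊢ x ≼ y
  tails x∈ y∈ = let x∈X , x∉A = ∈-∖⁻ {X = X} x∈
                    y∈X , y∉A = ∈-∖⁻ {X = X} y∈
                    i = ≼-there B D (λ p → x∉A (B⊆A p)) (λ p → y∉A (B⊆A p))
                    j = ≼-there A C x∉A y∉A
                in mk⇔ (λ le → to i (to (e x∈X y∈X) (from j le))) (λ le → to j (from (e x∈X y∈X) (from i le)))

-- Restriction of set compositions

restrict-yes : ∀ (B : Subset N) C {Y} → Nonempty (B ∩ Y) → restrictSC (B ∷ C) Y ≡ (B ∩ Y) ∷ restrictSC C Y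
restrict-yes B C {Y} ne = filter-accept (T? ∘ nonempty) (T-reflect (nonempty-reflects (B ∩ Y)) ne)

restrict-no : ∀ (B : Subset N) C {Y} → ¬ Nonempty (B ∩ Y) → restrictSC (B ∷ C) Y ≡ restrictSC C Y
restrict-no B C {Y} ¬ne = filter-reject (T? ∘ nonempty) {x = B ∩ Y} {xs = map (_∩ Y) C} (¬ne ∘ reflect-T (nonempty-reflects (B ∩ Y)))

Comp-restrict : ∀ Y → Comp X C → Comp (X ∩ Y) (restrictSC C Y)
Comp-restrict {X = X} Y (nil ∉X) = nil λ x x∈ → ∉X x (proj₁ (x∈p∩q⁻ X Y x∈))
Comp-restrict {X = X} Y (cons {B = B} {C = C} ne B⊆X c) with nonempty? (B ∩ Y)
... | yes ne' = subst (Comp (X ∩ Y)) (sym (restrict-yes B C ne'))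
  (cons ne' (λ x∈ → let x∈B , x∈Y = x∈p∩q⁻ B Y x∈ in x∈p∩q⁺ (B⊆X x∈B , x∈Y))
   (Comp-resp
     (λ x∈ → let x∈' , x∈Y = x∈p∩q⁻ (X ∖ B) Y x∈
                 x∈X , x∉B = ∈-∖⁻ {X = X} x∈' in
       ∈-∖⁺ (x∈p∩q⁺ (x∈X , x∈Y)) λ x∈BY → x∉B (proj₁ (x∈p∩q⁻ B Y x∈BY)))
     (λ x∈ → let x∈' , x∉ = ∈-∖⁻ {X = X ∩ Y} x∈
                 x∈X , x∈Y = x∈p∩q⁻ X Y x∈' in
       x∈p∩q⁺ (∈-∖⁺ x∈X (λ x∈B → x∉ (x∈p∩q⁺ (x∈B , x∈Y))) , x∈Y))
     (Comp-restrict Y c)))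
... | no ¬ne' = subst (Comp (X ∩ Y)) (sym (restrict-no B C ¬ne')) (Comp-resp
     (λ x∈ → let x∈' , x∈Y = x∈p∩q⁻ (X ∖ B) Y x∈ in x∈p∩q⁺ (proj₁ (∈-∖⁻ {X = X} x∈') , x∈Y))
     (λ x∈ → let x∈X , x∈Y = x∈p∩q⁻ X Y x∈ in
       x∈p∩q⁺ (∈-∖⁺ x∈X (λ x∈B → ¬ne' (_ , x∈p∩q⁺ (x∈B , x∈Y))) , x∈Y))
     (Comp-restrict Y c))

Comp-restrict-⊆ : Comp X C → Y ⊆ X → Comp Y (restrictSC C Y)
Comp-restrict-⊆ {X = X} {Y = Y} c Y⊆X = Comp-resp (λ x∈ → proj₂ (x∈p∩q⁻ X Y x∈)) (λ x∈ → x∈p∩q⁺ (Y⊆X x∈ , x∈)) (Comp-restrict Y c)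

-- Discarding empty intersections renumbers the blocks but does not change which of two points of
-- `Y` comes first.
restrict-≼ : ∀ (C : SC N) → x ∈ˢ Y → y ∈ˢ Y → restrictSC C Y ⊢ x ≼ y ⇔ C ⊢ x ≼ y
restrict-≼ [] x∈ y∈ = mk⇔ id id
restrict-≼ {x = x} {Y = Y} {y = y} (B ∷ C) x∈ y∈ with nonempty? (B ∩ Y)
... | no ¬ne = subst (λ D → D ⊢ x ≼ y ⇔ B ∷ C ⊢ x ≼ y) (sym (restrict-no B C ¬ne))
      (mk⇔ (from there' ∘ to (restrict-≼ C x∈ y∈)) (from (restrict-≼ C x∈ y∈) ∘ to there'))
  where
  there' = ≼-there B C (λ x∈B → ¬ne (x , x∈p∩q⁺ (x∈B , x∈))) (λ y∈B → ¬ne (y , x∈p∩q⁺ (y∈B , y∈)))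
... | yes ne = subst (λ D → D ⊢ x ≼ y ⇔ B ∷ C ⊢ x ≼ y) (sym (restrict-yes B C ne)) (cases (x ∈? B) (y ∈? B))
  where
  CY = restrictSC C Y
  ∉∩ : ∀ {z} → z ∉ˢ B → z ∉ˢ B ∩ Y
  ∉∩ z∉ z∈ = z∉ (proj₁ (x∈p∩q⁻ B Y z∈))
  cases : Dec (x ∈ˢ B) → Dec (y ∈ˢ B) → (B ∩ Y) ∷ CY ⊢ x ≼ y ⇔ B ∷ C ⊢ x ≼ y
  cases (yes x∈B) _         = mk⇔ (λ _ → ≼-here B C x∈B) (λ _ → ≼-here (B ∩ Y) CY (x∈p∩q⁺ (x∈B , x∈)))
  cases (no x∉B)  (yes y∈B) = mk⇔ (λ le → contradiction le (≼-not-here (B ∩ Y) CY (∉∩ x∉B) (x∈p∩q⁺ (y∈B , y∈))))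
                                  (λ le → contradiction le (≼-not-here B C x∉B y∈B))
  cases (no x∉B)  (no y∉B)  = mk⇔
    (from (≼-there B C x∉B y∉B) ∘ to (restrict-≼ C x∈ y∈) ∘ to (≼-there (B ∩ Y) CY (∉∩ x∉B) (∉∩ y∉B)))
    (from (≼-there (B ∩ Y) CY (∉∩ x∉B) (∉∩ y∉B)) ∘ from (restrict-≼ C x∈ y∈) ∘ to (≼-there B C x∉B y∉B))

restrict-restrict : ∀ (C : SC N) → Z ⊆ Y → restrictSC (restrictSC C Y) Z ≡ restrictSC C Z
restrict-restrict []      _   = refl
restrict-restrict {Z = Z} {Y = Y} (B ∷ C) Z⊆Y with nonempty? (B ∩ Y) | nonempty? (B ∩ Z)
... | no ¬ne | yes (x , x∈) = let x∈B , x∈Z = x∈p∩q⁻ B Z x∈ in contradiction (x , x∈p∩q⁺ (x∈B , Z⊆Y x∈Z)) ¬ne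
... | no ¬ne | no ¬ne' = trans (cong (λ D → restrictSC D Z) (restrict-no B C ¬ne))
      (trans (restrict-restrict C Z⊆Y) (sym (restrict-no B C ¬ne')))
... | yes ne | nez = trans (cong (λ D → restrictSC D Z) (restrict-yes B C ne)) (cases nez)
  where
  BYZ : (B ∩ Y) ∩ Z ≡ B ∩ Z
  BYZ = ⊆-antisym (λ x∈ → let x∈BY , x∈Z = x∈p∩q⁻ (B ∩ Y) Z x∈ in x∈p∩q⁺ (proj₁ (x∈p∩q⁻ B Y x∈BY) , x∈Z))
                  (λ x∈ → let x∈B , x∈Z = x∈p∩q⁻ B Z x∈ in x∈p∩q⁺ (x∈p∩q⁺ (x∈B , Z⊆Y x∈Z) , x∈Z))
  cases : Dec (Nonempty (B ∩ Z)) → restrictSC ((B ∩ Y) ∷ restrictSC C Y) Z ≡ restrictSC (B ∷ C) Z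
  cases (yes ne') = trans (restrict-yes (B ∩ Y) (restrictSC C Y) (subst Nonempty (sym BYZ) ne'))
    (trans (cong₂ _∷_ BYZ (restrict-restrict C Z⊆Y)) (sym (restrict-yes B C ne')))
  cases (no ¬ne') = trans (restrict-no (B ∩ Y) (restrictSC C Y) (λ ne' → ¬ne' (subst Nonempty BYZ ne')))
    (trans (restrict-restrict C Z⊆Y) (sym (restrict-no B C ¬ne')))

-- `glue D E` refines E by D inside each block, so its preorder is the lexicographic product.

glue : SC N → SC N → SC N
glue D E = concat (map (restrictSC D) E)

⋃-restrict : Comp X D → Y ⊆ X → ⋃ (restrictSC D Y) ≡ Y
⋃-restrict d Y⊆X = ⋃-Comp (Comp-restrict-⊆ d Y⊆X)

Comp-glue : Comp X D → Comp Y E → Y ⊆ X → Comp Y (glue D E)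
Comp-glue d (nil ∉Y) _ = nil ∉Y
Comp-glue {Y = Y} d (cons _ B⊆Y e) Y⊆X = Comp-++⁺ (Comp-restrict-⊆ d (λ x∈ → Y⊆X (B⊆Y x∈))) B⊆Y
  (Comp-glue d e (λ x∈ → Y⊆X (proj₁ (∈-∖⁻ {X = Y} x∈))))

-- The induction peels blocks off `E`, shrinking `Y`, while `D` stays a composition of the whole of
-- `X`; hence two underlying sets.
glue-≼ : Comp X D → Comp Y E → Y ⊆ X → x ∈ˢ Y → y ∈ˢ Y →
         glue D E ⊢ x ≼ y ⇔ (E ⊢ x ≼ y × (E ⊢ y ≼ x → D ⊢ x ≼ y))
glue-≼ d (nil ∉Y) _ x∈ _ = contradiction x∈ (∉Y _)
glue-≼ {D = D} {Y = Y} {x = x} {y = y} d (cons {B = B} {C = E} _ B⊆Y e) Y⊆X x∈ y∈ = cases (x ∈? B) (y ∈? B)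
  where
  ⋃DB : ⋃ (restrictSC D B) ≡ B
  ⋃DB = ⋃-restrict d (λ x∈ → Y⊆X (B⊆Y x∈))
  in' : ∀ {z} → z ∈ˢ B → z ∈ˢ ⋃ (restrictSC D B)
  in' = subst (_ ∈ˢ_) (sym ⋃DB)
  out' : ∀ {z} → z ∉ˢ B → z ∉ˢ ⋃ (restrictSC D B)
  out' z∉ z∈ = z∉ (subst (_ ∈ˢ_) ⋃DB z∈)
  DB = restrictSC D B
  DE = glue D E
  cases : Dec (x ∈ˢ B) → Dec (y ∈ˢ B) → DB ++ DE ⊢ x ≼ y ⇔ (B ∷ E ⊢ x ≼ y × (B ∷ E ⊢ y ≼ x → D ⊢ x ≼ y))
  cases (yes x∈B) (yes y∈B) = mk⇔
    (λ le → ≼-here B E x∈B , λ _ → to (restrict-≼ D x∈B y∈B) (to (≼-++ˡˡ DB DE (in' x∈B) (in' y∈B)) le))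
    (λ { (_ , h) → from (≼-++ˡˡ DB DE (in' x∈B) (in' y∈B)) (from (restrict-≼ D x∈B y∈B) (h (≼-here B E y∈B))) })
  cases (yes x∈B) (no y∉B) = mk⇔
    (λ _ → ≼-here B E x∈B , λ le → contradiction le (≼-not-here B E y∉B x∈B))
    (λ _ → <⇒≤ (pos-< DB DE (in' x∈B) (out' y∉B)))
  cases (no x∉B) (yes y∈B) = mk⇔
    (λ le → contradiction le (<⇒≱ (pos-< DB DE (in' y∈B) (out' x∉B))))
    (λ { (le , _) → contradiction le (≼-not-here B E x∉B y∈B) })
  cases (no x∉B) (no y∉B) = mk⇔
    (λ le → let p , q = to IH (to (≼-++ʳʳ DB DE (out' x∉B) (out' y∉B)) le) in
            from (≼-there B E x∉B y∉B) p , λ le' → q (to (≼-there B E y∉B x∉B) le'))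
    (λ { (p , q) → from (≼-++ʳʳ DB DE (out' x∉B) (out' y∉B))
            (from IH (to (≼-there B E x∉B y∉B) p , λ le → q (from (≼-there B E y∉B x∉B) le))) })
    where
    IH = glue-≼ d e (λ z∈ → Y⊆X (proj₁ (∈-∖⁻ {X = Y} z∈))) (∈-∖⁺ x∈ x∉B) (∈-∖⁺ y∈ y∉B)

-- Linear extensions

-- For x < y the second clause, read contrapositively, makes the inequality of positions strict; for
-- x ∼ y the first clause in both directions gives equal positions. This single implication replaces
-- the two of the usual definition.
LinExt : Subset N → Fam N → SC N → Set
LinExt X 𝒯 C = Comp X C ×
  (∀ {x y} → x ∈ˢ X → y ∈ˢ X → Le 𝒯 x y → C ⊢ x ≼ y × (C ⊢ y ≼ x → Le 𝒯 y x))

-- `upTo` is `applyUpTo id`, and passing to the tail replaces `f` by `f ∘ suc`, so the induction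
-- needs a general `f`.
∈-indexed : ∀ (f : ℕ → ℕ) → Comp X C → x ∈ˢ X →
            ∃ λ B → (f (pos C x) , B) ∈ zip (applyUpTo f (length C)) C × x ∈ˢ B
∈-indexed f (nil ∉X) x∈ = contradiction x∈ (∉X _)
∈-indexed {x = x} f (cons {B = B} {C = C} _ _ c) x∈ with x ∈? B
... | yes x∈B = B , here (cong (λ i → f i , B) (pos-∈ B C x∈B)) , x∈B
... | no x∉B  = let A , A∈ , x∈A = ∈-indexed (f ∘ suc) c (∈-∖⁺ x∈ x∉B) in
      A , there (subst (λ i → (f i , A) ∈ zip (applyUpTo (f ∘ suc) (length C)) C) (sym (pos-∉ B C x∉B)) A∈) , x∈A

indexed-pos : ∀ (f : ℕ → ℕ) {i A} → Comp X C → (i , A) ∈ zip (applyUpTo f (length C)) C → x ∈ˢ A →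
              x ∈ˢ X × i ≡ f (pos C x)
indexed-pos f (cons {B = B} {C = C} _ B⊆X c) (here refl) x∈ = B⊆X x∈ , cong f (sym (pos-∈ B C x∈))
indexed-pos {X = X} f (cons {B = B} {C = C} _ B⊆X c) (there A∈) x∈ =
  let x∈' , e = indexed-pos (f ∘ suc) c A∈ x∈
      x∈X , x∉B = ∈-∖⁻ {X = X} x∈'
  in x∈X , trans e (cong f (sym (pos-∉ B C x∉B)))

isLinExt-reflects : ∀ X (𝒯 : Fam N) C → Reflects (LinExt X 𝒯 C) (isLinExtᵇ X 𝒯 C)
isLinExt-reflects {N} X 𝒯 C = reflects-map fwd bwd
  (isSC-reflects X C ×-reflects all-∈-reflects (λ iA → all-∈-reflects (λ jB →
     all-reflects ∈-allFin λ x → all-reflects ∈-allFin λ y →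
       (∈-reflects x (proj₂ iA) ×-reflects ∈-reflects y (proj₂ jB)) →-reflects
       ((Lt-reflects 𝒯 x y →-reflects proof (proj₁ iA <? proj₁ jB)) ×-reflects
        (Sim-reflects 𝒯 x y →-reflects proof (proj₁ iA ≟ proj₁ jB)))) ic) ic)
  where
  ic = zip (upTo (length C)) C
  Indexed : Set
  Indexed = ∀ iA → iA ∈ ic → ∀ jB → jB ∈ ic → ∀ x y → x ∈ˢ proj₂ iA × y ∈ˢ proj₂ jB →
      (Le 𝒯 x y × ¬ Le 𝒯 y x → proj₁ iA < proj₁ jB) × (Le 𝒯 x y × Le 𝒯 y x → proj₁ iA ≡ proj₁ jB)
  fwd : Comp X C × Indexed → LinExt X 𝒯 C
  fwd (c , h) = c , λ {x} {y} x∈ y∈ le →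
    let A , A∈ , x∈A = ∈-indexed id c x∈
        B , B∈ , y∈B = ∈-indexed id c y∈
        lt , eq = h _ A∈ _ B∈ x y (x∈A , y∈B)
    in cases x y le lt eq (Le? 𝒯 y x)
    where
    cases : ∀ x y → Le 𝒯 x y → (Le 𝒯 x y × ¬ Le 𝒯 y x → pos C x < pos C y) →
            (Le 𝒯 x y × Le 𝒯 y x → pos C x ≡ pos C y) → Dec (Le 𝒯 y x) →
            C ⊢ x ≼ y × (C ⊢ y ≼ x → Le 𝒯 y x)
    cases x y le lt eq (yes ge) = ≤-reflexive (eq (le , ge)) , λ _ → ge
    cases x y le lt eq (no ¬ge) = <⇒≤ (lt (le , ¬ge)) , λ yx → contradiction yx (<⇒≱ (lt (le , ¬ge)))
  bwd : LinExt X 𝒯 C → Comp X C × Indexed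
  bwd (c , h) = c , λ { (i , A) A∈ (j , B) B∈ x y (x∈A , y∈B) →
    let x∈ , ei = indexed-pos id c A∈ x∈A
        y∈ , ej = indexed-pos id c B∈ y∈B
    in (λ { (le , ¬ge) → subst₂ _<_ (sym ei) (sym ej) (≰⇒> λ yx → ¬ge (proj₂ (h x∈ y∈ le) yx)) })
     , (λ { (le , ge) → trans ei (trans (≤-antisym (proj₁ (h x∈ y∈ le)) (proj₁ (h y∈ x∈ ge))) (sym ej)) }) }

∈-linExts : {𝒯 : Fam N} → ground 𝒯 ≡ X → C ∈ linExts 𝒯 ⇔ LinExt X 𝒯 C
∈-linExts {𝒯 = 𝒯} refl = mk⇔ (λ C∈ → proj₂ (to mem C∈))
  (λ l → from mem (from (∈-allSC (ground 𝒯)) (proj₁ l) , l))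
  where
  mem : ∀ {C} → C ∈ linExts 𝒯 ⇔ (C ∈ allSC (ground 𝒯) × LinExt (ground 𝒯) 𝒯 C)
  mem = filterᵇ-∈-⇔ (isLinExt-reflects (ground 𝒯) 𝒯)

linExts-unique : (𝒯 : Fam N) → Unique (linExts 𝒯)
linExts-unique 𝒯 = Uniqueₚ.filter⁺ (T? ∘ isLinExtᵇ (ground 𝒯) 𝒯) (allSC-unique (ground 𝒯))

-- Segmentations

NonNil : {A : Set} → List A → Set
NonNil xs = xs ≢ []

segmentations-concat : ∀ {A : Set} (as : List A) {s} → s ∈ segmentations as → concat s ≡ as × All NonNil s
segmentations-concat []       (here refl) = refl , []
segmentations-concat (a ∷ as) s∈ with to (concatMap-∈-⇔ {xs = segmentations as}) s∈
... | []     , t∈ , here refl         = cong (a ∷_) (proj₁ (segmentations-concat as t∈)) , (λ ()) ∷ []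
... | b ∷ bs , t∈ , here refl         = let e , nn = segmentations-concat as t∈ in cong (a ∷_) e , (λ ()) ∷ nn
... | b ∷ bs , t∈ , there (here refl) = let e , nn = segmentations-concat as t∈ in cong (a ∷_) e , (λ ()) ∷ All.tail nn

∈-segmentations : ∀ {A : Set} (as : List A) {s} → All NonNil s → concat s ≡ as → s ∈ segmentations as
∈-segmentations []       {[]}                  _        _ = here refl
∈-segmentations []       {[] ∷ s}              (n ∷ _)  _ = contradiction refl n
∈-segmentations (a ∷ as) {[] ∷ s}              (n ∷ _)  _ = contradiction refl n
∈-segmentations (a ∷ as) {(b ∷ []) ∷ s}        (_ ∷ nn) e with ∷-injective e
... | refl , e' = from concatMap-∈-⇔ (s , ∈-segmentations as nn e' , here refl)
∈-segmentations (a ∷ as) {(b ∷ b' ∷ bs) ∷ s}   (_ ∷ nn) e with ∷-injective e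
... | refl , e' = from concatMap-∈-⇔ ((b' ∷ bs) ∷ s , ∈-segmentations as ((λ ()) ∷ nn) e' , there (here refl))

-- The head either stands alone or joins the first segment of the rest. Segments being nonempty, the
-- first segment has one element in the former case and more in the latter, so the choice and the
-- rest can both be read off.
segmentations-unique : ∀ {A : Set} (as : List A) → Unique (segmentations as)
segmentations-unique []       = [] ∷ []
segmentations-unique (a ∷ as) = concatMap-unique (segmentations-unique as)
  (λ { {[]} _ → [] ∷ []
     ; {b ∷ bs} s∈ → ((λ e → head-nonNil s∈ (sym (∷-injectiveʳ (∷-injectiveˡ e)))) ∷ []) ∷ [] ∷ [] })
  (λ { {[]} {[]} _ _ _ _ → refl
     ; {[]} {_ ∷ _} _ q (here refl) (there (here e)) → contradiction (sym (∷-injectiveʳ (∷-injectiveˡ e))) (head-nonNil q)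
     ; {_ ∷ _} {[]} p _ (there (here e)) (here refl) → contradiction (sym (∷-injectiveʳ (∷-injectiveˡ e))) (head-nonNil p)
     ; {_ ∷ _} {_ ∷ _} _ _ (here refl) (here e) → ∷-injectiveʳ e
     ; {_ ∷ _} {_ ∷ _} _ q (here refl) (there (here e)) → contradiction (sym (∷-injectiveʳ (∷-injectiveˡ e))) (head-nonNil q)
     ; {_ ∷ _} {_ ∷ _} p _ (there (here refl)) (here e) → contradiction (∷-injectiveʳ (∷-injectiveˡ e)) (head-nonNil p)
     ; {_ ∷ _} {_ ∷ _} _ _ (there (here refl)) (there (here refl)) → refl })
  where
  head-nonNil : ∀ {b bs} → (b ∷ bs) ∈ segmentations as → NonNil b
  head-nonNil s∈ = All.head (proj₂ (segmentations-concat as s∈))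

-- The quotient topology and admissibility

Rel : Subset N → Fam N → Fam N → Fin N → Fin N → Set
Rel X 𝒯 𝒯' x y = x ∈ˢ X × y ∈ˢ X × (Le 𝒯 x y ⊎ Le 𝒯' y x)

module Quotient (X : Subset N) (𝒯 𝒯' : Fam N) where

  Open-quot : ∀ {U} → Open (quot X 𝒯 𝒯') U ⇔ (U ⊆ X × (∀ x y → x ∈ˢ U × Rel X 𝒯 𝒯' x y → y ∈ˢ U))
  Open-quot = Open-transClos X λ x y →
    ∈-reflects x X ×-reflects (∈-reflects y X ×-reflects (Le-reflects 𝒯 x y ⊎-reflects Le-reflects 𝒯' y x))

  Rel-∈ : ∀ {x y} → Rel X 𝒯 𝒯' x y → y ∈ˢ X
  Rel-∈ (_ , y∈ , _) = y∈

  quot-isTop : IsTop X (quot X 𝒯 𝒯')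
  quot-isTop = closed-isTop X (quot X 𝒯 𝒯') Open-quot Rel-∈

  Rel⇒Le : ∀ {x y} → Rel X 𝒯 𝒯' x y → Le (quot X 𝒯 𝒯') x y
  Rel⇒Le = R⇒Le X (quot X 𝒯 𝒯') Open-quot Rel-∈

  Le-quot-least : {S : Fin N → Set} (S? : ∀ z → Dec (S z)) → ∀ {x y} → x ∈ˢ X → S x →
    (∀ {z w} → z ∈ˢ X → S z → Rel X 𝒯 𝒯' z w → S w) → Le (quot X 𝒯 𝒯') x y → S y
  Le-quot-least = Le-least X (quot X 𝒯 𝒯') Open-quot Rel-∈

Separated : Fam N → Subset N → Set
Separated 𝒯 Y = ∃ λ U → ∃ λ V → Open (𝒯 ∣ Y) U × Open (𝒯 ∣ Y) V × Nonempty U × Nonempty V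
                                × U ∩ V ≡ ∅ × U ∪ V ≡ Y

connected-reflects : (𝒯 : Fam N) (Y : Subset N) → Reflects (¬ Separated 𝒯 Y) (connectedᵇ 𝒯 Y)
connected-reflects 𝒯 Y = ¬-reflects (any-reflects ∈-allSubsets λ U → any-reflects ∈-allSubsets λ V →
  Open-reflects (𝒯 ∣ Y) U ×-reflects (Open-reflects (𝒯 ∣ Y) V ×-reflects
  (nonempty-reflects U ×-reflects (nonempty-reflects V ×-reflects
  (=ˢ-reflects (U ∩ V) ∅ ×-reflects =ˢ-reflects (U ∪ V) Y)))))

Sim : Fam N → Fin N → Fin N → Set
Sim 𝒯 x y = Le 𝒯 x y × Le 𝒯 y x

Admissible : Subset N → Fam N → Fam N → Set
Admissible X 𝒯 𝒯' = IsTop X 𝒯' × (∀ U → Open 𝒯 U → Open 𝒯' U)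
  × (∀ Y → Y ⊆ X × ¬ Separated 𝒯' Y → 𝒯' ∣ Y ≡ 𝒯 ∣ Y)
  × (∀ x y → x ∈ˢ X × y ∈ˢ X →
       (Sim (quot X 𝒯 𝒯') x y × Sim (quot X 𝒯' 𝒯') x y)
       ⊎ (¬ Sim (quot X 𝒯 𝒯') x y × ¬ Sim (quot X 𝒯' 𝒯') x y))

admissible-reflects : ∀ X (𝒯 𝒯' : Fam N) → Reflects (Admissible X 𝒯 𝒯') (admissibleᵇ X 𝒯 𝒯')
admissible-reflects X 𝒯 𝒯' = isTop-reflects X 𝒯'
  ×-reflects (all-reflects ∈-allSubsets (λ U → Open-reflects 𝒯 U →-reflects Open-reflects 𝒯' U)
  ×-reflects (all-reflects ∈-allSubsets (λ Y → (⊆-reflects Y X ×-reflects connected-reflects 𝒯' Y)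
                →-reflects proof ((𝒯' ∣ Y) ≟F (𝒯 ∣ Y)))
  ×-reflects all-reflects ∈-allFin (λ x → all-reflects ∈-allFin λ y →
       (∈-reflects x X ×-reflects ∈-reflects y X) →-reflects
       ((Sim-reflects (quot X 𝒯 𝒯') x y ×-reflects Sim-reflects (quot X 𝒯' 𝒯') x y)
        ⊎-reflects (¬-reflects (Sim-reflects (quot X 𝒯 𝒯') x y)
                    ×-reflects ¬-reflects (Sim-reflects (quot X 𝒯' 𝒯') x y))))))

-- Connected components as the classes of 𝒯/𝒯

module _ {X : Subset N} {𝒯 : Fam N} (top : IsTop X 𝒯) {x : Fin N} (x∈X : x ∈ˢ X) where
  open Quotient X 𝒯 𝒯

  private
    inComponent? : ∀ z → Dec (z ∈ˢ X × Le (quot X 𝒯 𝒯) x z)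
    inComponent? z = (z ∈? X) ×-dec Le? (quot X 𝒯 𝒯) x z

  -- The relation generating 𝒯/𝒯 is symmetric, so its preorder is reachability by zigzags, and this
  -- is the connected component of `x`.
  component : Subset N
  component = ⟦ inComponent? ⟧

  ∈-component : ∀ {z} → z ∈ˢ component ⇔ (z ∈ˢ X × Le (quot X 𝒯 𝒯) x z)
  ∈-component = ∈-⟦⟧ inComponent?

  -- `U` is open, hence closed upwards in the component; it is also closed downwards, since a step
  -- down into `V` could be undone by a step up inside the open set `V`. So `U` contains every
  -- zigzag from `x`.
  component-covered : ∀ {U V} → Open (𝒯 ∣ component) U → Open (𝒯 ∣ component) V →
    U ∩ V ≡ ∅ → U ∪ V ≡ component → x ∈ˢ U → ¬ Nonempty V
  component-covered {U} {V} oU oV disj cover x∈U (v , v∈V) =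
    not-both (Le-quot-least (_∈? U) x∈X x∈U step (proj₂ (to ∈-component (Open-∣-⊆ 𝒯 oV v∈V)))) v∈V
    where
    not-both : ∀ {z} → z ∈ˢ U → ¬ z ∈ˢ V
    not-both z∈U z∈V = ∉⊥ (subst (_ ∈ˢ_) disj (x∈p∩q⁺ (z∈U , z∈V)))
    step : ∀ {z w} → z ∈ˢ X → z ∈ˢ U → Rel X 𝒯 𝒯 z w → w ∈ˢ U
    step {z} {w} z∈X z∈U r@(_ , w∈X , le) = cases (x∈p∪q⁻ U V (subst (w ∈ˢ_) (sym cover) w∈Y)) le
      where
      w∈Y : w ∈ˢ component
      w∈Y = from ∈-component (w∈X , Le-trans (quot X 𝒯 𝒯) (proj₂ (to ∈-component (Open-∣-⊆ 𝒯 oU z∈U))) (Rel⇒Le r))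
      cases : w ∈ˢ U ⊎ w ∈ˢ V → Le 𝒯 z w ⊎ Le 𝒯 w z → w ∈ˢ U
      cases (inj₁ w∈U) _         = w∈U
      cases (inj₂ w∈V) (inj₁ le) = Open-∣-closed top oU z∈U w∈Y le
      cases (inj₂ w∈V) (inj₂ ge) = contradiction (Open-∣-closed top oV w∈V (Open-∣-⊆ 𝒯 oU z∈U) ge) (not-both z∈U)

  component-connected : ¬ Separated 𝒯 component
  component-connected (U , V , oU , oV , neU , neV , disj , cover)
    with x∈p∪q⁻ U V (subst (x ∈ˢ_) (sym cover) (from ∈-component (x∈X , Le-refl (quot X 𝒯 𝒯))))
  ... | inj₁ x∈U = component-covered oU oV disj cover x∈U neV
  ... | inj₂ x∈V = component-covered oV oU (trans (∩-comm V U) disj) (trans (∪-comm V U) cover) x∈V neU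

-- An admissible 𝒯' having a linear extension E of the quotient is 𝒯 cut along the blocks of E.

module _ {X : Subset N} {𝒯 𝒯' : Fam N} (adm : Admissible X 𝒯 𝒯') {E : SC N} (ext : LinExt X (quot X 𝒯 𝒯') E) where
  private
    top'  = proj₁ adm
    finer = proj₁ (proj₂ adm)
    agree = proj₁ (proj₂ (proj₂ adm))
    sim   = proj₂ (proj₂ (proj₂ adm))
    module Q = Quotient X 𝒯 𝒯'

  admissible⇒Le : Le 𝒯' x y → Le 𝒯 x y
  admissible⇒Le le U (o , x∈) = le U (finer U o , x∈)

  -- The direction is reversed because the quotient reverses the relations of 𝒯'.
  admissible⇒≽ : x ∈ˢ X → y ∈ˢ X → Le 𝒯' x y → E ⊢ y ≼ x
  admissible⇒≽ x∈ y∈ le = proj₁ (proj₂ ext y∈ x∈ (Q.Rel⇒Le (y∈ , x∈ , inj₂ le)))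

  ≤-quotient : x ∈ˢ X → y ∈ˢ X → Le 𝒯 x y → Le (quot X 𝒯 𝒯') x y
  ≤-quotient x∈ y∈ le = Q.Rel⇒Le (x∈ , y∈ , inj₁ le)

  cut⇒admissible : x ∈ˢ X → y ∈ˢ X → Le 𝒯 x y → E ⊢ y ≼ x → Le 𝒯' x y
  cut⇒admissible {x = x} {y = y} x∈ y∈ le ge with sim x y (x∈ , y∈)
  -- From x ≤ y in the quotient and y ≼ x in `E`, the linear extension gives y ≤ x in the quotient,
  -- so the points are equivalent there.
  ... | inj₂ (¬s , _) = contradiction (q , proj₂ (proj₂ ext x∈ y∈ q) ge) ¬s
    where q = ≤-quotient x∈ y∈ le
  -- Equivalence in 𝒯'/𝒯' places both points in one connected component of 𝒯', where 𝒯 and 𝒯' induce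
  -- the same topology.
  ... | inj₁ (_ , (q' , _)) = to (Le-∣ 𝒯' x∈K y∈K)
      (subst (λ F → Le F x y) (sym (agree K ((λ z∈ → proj₁ (to (∈-component top' x∈) z∈)) , component-connected top' x∈)))
        (from (Le-∣ 𝒯 x∈K y∈K) le))
    where
    K = component top' x∈
    x∈K : x ∈ˢ K
    x∈K = from (∈-component top' x∈) (x∈ , Le-refl (quot X 𝒯' 𝒯'))
    y∈K : y ∈ˢ K
    y∈K = from (∈-component top' x∈) (y∈ , q')

admissible-unique : {𝒯 𝒯₁ 𝒯₂ : Fam N} → Admissible X 𝒯 𝒯₁ → Admissible X 𝒯 𝒯₂ →
  LinExt X (quot X 𝒯 𝒯₁) E → LinExt X (quot X 𝒯 𝒯₂) E → 𝒯₁ ≡ 𝒯₂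
admissible-unique a₁ a₂ e₁ e₂ = Open-ext
  (⊆-by-Le (proj₁ a₁) (proj₁ a₂) λ x∈ y∈ le →
    cut⇒admissible a₁ e₁ x∈ y∈ (admissible⇒Le a₂ e₂ le) (admissible⇒≽ a₂ e₂ x∈ y∈ le))
  (⊆-by-Le (proj₁ a₂) (proj₁ a₁) λ x∈ y∈ le →
    cut⇒admissible a₂ e₂ x∈ y∈ (admissible⇒Le a₁ e₁ le) (admissible⇒≽ a₁ e₁ x∈ y∈ le))

-- A relation x ≤ y of 𝒯 survives in the quotient, so `E` puts x no later than y; if `E` ties them,
-- the relation already belongs to 𝒯' and `D` decides.
admissible⇒glue : {𝒯 𝒯' : Fam N} → Admissible X 𝒯 𝒯' → LinExt X 𝒯' D → LinExt X (quot X 𝒯 𝒯') E →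
  LinExt X 𝒯 (glue D E)
admissible⇒glue {X = X} {D = D} {E = E} {𝒯 = 𝒯} {𝒯'} a d e = Comp-glue (proj₁ d) (proj₁ e) id , λ x∈ y∈ le →
  let xEy = proj₁ (proj₂ e x∈ y∈ (≤-quotient a e x∈ y∈ le)) in
    from (gl x∈ y∈) (xEy , λ yEx → proj₁ (proj₂ d x∈ y∈ (cut⇒admissible a e x∈ y∈ le yEx)))
  , λ ge → let yEx , h = to (gl y∈ x∈) ge in
      admissible⇒Le a e (proj₂ (proj₂ d x∈ y∈ (cut⇒admissible a e x∈ y∈ le yEx)) (h xEy))
  where
  gl : ∀ {x y} → x ∈ˢ X → y ∈ˢ X → glue D E ⊢ x ≼ y ⇔ (E ⊢ x ≼ y × (E ⊢ y ≼ x → D ⊢ x ≼ y))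
  gl = glue-≼ (proj₁ d) (proj₁ e) id

-- Topologies of preorders

module Preorder (X : Subset N) {R : Fin N → Fin N → Set} (R? : ∀ x y → Dec (R x y))
  (R-∈ : ∀ {x y} → R x y → y ∈ˢ X) (R-refl : ∀ {x} → x ∈ˢ X → R x x)
  (R-trans : ∀ {x y z} → R x y → R y z → R x z) where

  topology : Fam N
  topology = topOfQO X (λ x y → does (R? x y))

  private
    Open-topology : ∀ {U} → Open topology U ⇔ (U ⊆ X × (∀ x y → x ∈ˢ U × R x y → y ∈ˢ U))
    Open-topology = Open-topOfQO X λ x y → proof (R? x y)

  isTop : IsTop X topology
  isTop = closed-isTop X topology Open-topology R-∈

  Le-⇔ : ∀ {x y} → x ∈ˢ X → Le topology x y ⇔ R x y
  Le-⇔ {x} x∈ = mk⇔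
    (Le-least X topology Open-topology R-∈ (R? x) x∈ (R-refl x∈) (λ _ → R-trans))
    (R⇒Le X topology Open-topology R-∈)

-- The cut of a topology along the blocks of a set composition

module _ {X : Subset N} {𝒯 : Fam N} (top : IsTop X 𝒯) {D E : SC N} (d : Comp X D) (e : Comp X E)
  (ext : LinExt X 𝒯 (glue D E)) where
  private
    gl : ∀ {x y} → x ∈ˢ X → y ∈ˢ X → glue D E ⊢ x ≼ y ⇔ (E ⊢ x ≼ y × (E ⊢ y ≼ x → D ⊢ x ≼ y))
    gl = glue-≼ d e id

    mono : ∀ {x y} → x ∈ˢ X → y ∈ˢ X → Le 𝒯 x y → E ⊢ x ≼ y
    mono x∈ y∈ le = proj₁ (to (gl x∈ y∈) (proj₁ (proj₂ ext x∈ y∈ le)))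

    -- The opposite inequality of positions comes from `mono`, so this is the preorder of 𝒯 kept
    -- only inside the blocks of `E`.
    Cut : Fin N → Fin N → Set
    Cut x y = y ∈ˢ X × Le 𝒯 x y × E ⊢ y ≼ x

    Cut? : ∀ x y → Dec (Cut x y)
    Cut? x y = (y ∈? X) ×-dec (Le? 𝒯 x y ×-dec (pos E y ≤? pos E x))

    Cut-refl : ∀ {x} → x ∈ˢ X → Cut x x
    Cut-refl x∈ = x∈ , Le-refl 𝒯 , ≤-refl

    Cut-trans : ∀ {x y z} → Cut x y → Cut y z → Cut x z
    Cut-trans (_ , p , q) (z∈ , p' , q') = z∈ , Le-trans 𝒯 p p' , ≤-trans q' q

    module C = Preorder X Cut? proj₁ Cut-refl Cut-trans

  cut : Fam N
  cut = C.topology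

  private
    module Q  = Quotient X 𝒯 cut
    module Q' = Quotient X cut cut

    -- Each generating step respects `E`: a step of 𝒯 by `mono`, a reversed step of the cut by the
    -- inequality stored in `Cut`.
    quot-mono : ∀ {x y} → x ∈ˢ X → Le (quot X 𝒯 cut) x y → E ⊢ x ≼ y
    quot-mono {x} x∈ = Q.Le-quot-least (λ z → pos E x ≤? pos E z) x∈ ≤-refl λ z∈ le →
      λ { (_ , w∈ , inj₁ p) → ≤-trans le (mono z∈ w∈ p)
        ; (_ , w∈ , inj₂ p) → ≤-trans le (proj₂ (proj₂ (to (C.Le-⇔ w∈) p))) }

    quot'⇒quot : ∀ {x y} → x ∈ˢ X → Le (quot X cut cut) x y → Le (quot X 𝒯 cut) x y
    quot'⇒quot {x} x∈ = Q'.Le-quot-least (Le? (quot X 𝒯 cut) x) x∈ (Le-refl (quot X 𝒯 cut)) λ z∈ le →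
      λ { (_ , w∈ , inj₁ p) → Le-trans (quot X 𝒯 cut) le (Q.Rel⇒Le (z∈ , w∈ , inj₁ (proj₁ (proj₂ (to (C.Le-⇔ z∈) p)))))
        ; (_ , w∈ , inj₂ p) → Le-trans (quot X 𝒯 cut) le (Q.Rel⇒Le (z∈ , w∈ , inj₂ p)) }

    -- A chain from x to y inside one block of E consists of steps of the cut topology, so it can be reversed.
    quot-reverse : ∀ {x y} → x ∈ˢ X → Le (quot X 𝒯 cut) x y → E ⊢ y ≼ x → Le (quot X cut cut) y x
    quot-reverse {x} x∈ le = proj₂ (Q.Le-quot-least
      (λ z → (pos E x ≤? pos E z) ×-dec ((pos E z ≤? pos E x) →-dec Le? (quot X cut cut) z x))
      x∈ (≤-refl , λ _ → Le-refl (quot X cut cut)) step le)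
      where
      -- Only the end of the chain is known to lie in the block of `x`, so reversibility is a
      -- conditional invariant. Positions never decrease along the chain: if `w` is not after `x`,
      -- neither is `z`, and the step between them stays in the block.
      Back : Fin N → Set
      Back z = E ⊢ x ≼ z × (E ⊢ z ≼ x → Le (quot X cut cut) z x)
      step : ∀ {z w} → z ∈ˢ X → Back z → Rel X 𝒯 cut z w → Back w
      step {z} {w} z∈ (xz , back) r@(_ , w∈ , zw) = ≤-trans xz zEw , λ wx →
        Le-trans (quot X cut cut) (Q'.Rel⇒Le (w∈ , z∈ , rev (≤-trans wx xz) zw)) (back (≤-trans zEw wx))
        where
        zEw : E ⊢ z ≼ w
        zEw = quot-mono z∈ (Q.Rel⇒Le r)
        rev : E ⊢ w ≼ z → Le 𝒯 z w ⊎ Le cut w z → Le cut w z ⊎ Le cut z w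
        rev wEz (inj₁ p) = inj₂ (from (C.Le-⇔ z∈) (w∈ , p , wEz))
        rev wEz (inj₂ p) = inj₁ p

    -- If y came after x in `E`, then `Y` would split at the position of x. Points related by the
    -- cut share a block of `E`, so both halves are closed upwards, hence open, and they separate
    -- `Y`.
    connected⇒≼ : Y ⊆ X → ¬ Separated cut Y → x ∈ˢ Y → y ∈ˢ Y → E ⊢ y ≼ x
    connected⇒≼ {Y = Y} {x = x} {y = y} Y⊆X conn x∈ y∈ with pos E y ≤? pos E x
    ... | yes le = le
    ... | no ¬le = contradiction separated conn
      where
      below? : ∀ z → Dec (z ∈ˢ Y × E ⊢ z ≼ x)
      below? z = (z ∈? Y) ×-dec (pos E z ≤? pos E x)
      above? : ∀ z → Dec (z ∈ˢ Y × ¬ E ⊢ z ≼ x)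
      above? z = (z ∈? Y) ×-dec ¬? (pos E z ≤? pos E x)
      below = ⟦ below? ⟧
      above = ⟦ above? ⟧
      split : ∀ {z} → z ∈ˢ Y → Dec (E ⊢ z ≼ x) → z ∈ˢ below ∪ above
      split z∈ (yes p) = x∈p∪q⁺ (inj₁ (from (∈-⟦⟧ below?) (z∈ , p)))
      split z∈ (no ¬p) = x∈p∪q⁺ (inj₂ (from (∈-⟦⟧ above?) (z∈ , ¬p)))
      unsplit : ∀ {z} → z ∈ˢ below ⊎ z ∈ˢ above → z ∈ˢ Y
      unsplit (inj₁ p) = proj₁ (to (∈-⟦⟧ below?) p)
      unsplit (inj₂ p) = proj₁ (to (∈-⟦⟧ above?) p)
      separated : Separated cut Y
      separated = below , above
        , closed⇒Open-∣ C.isTop Y⊆X (λ z∈ → proj₁ (to (∈-⟦⟧ below?) z∈))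
            (λ z∈ w∈ le → let z∈Y , zx = to (∈-⟦⟧ below?) z∈ in
              from (∈-⟦⟧ below?) (w∈ , ≤-trans (proj₂ (proj₂ (to (C.Le-⇔ (Y⊆X z∈Y)) le))) zx))
        , closed⇒Open-∣ C.isTop Y⊆X (λ z∈ → proj₁ (to (∈-⟦⟧ above?) z∈))
            (λ z∈ w∈ le → let z∈Y , ¬zx = to (∈-⟦⟧ above?) z∈ in
              from (∈-⟦⟧ above?) (w∈ , λ wx → ¬zx (≤-trans
                (mono (Y⊆X z∈Y) (Y⊆X w∈) (proj₁ (proj₂ (to (C.Le-⇔ (Y⊆X z∈Y)) le)))) wx)))
        , (x , from (∈-⟦⟧ below?) (x∈ , ≤-refl))
        , (y , from (∈-⟦⟧ above?) (y∈ , ¬le))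
        , ⊆-antisym (λ z∈ → let z∈below , z∈above = x∈p∩q⁻ below above z∈ in
            contradiction (proj₂ (to (∈-⟦⟧ below?) z∈below)) (proj₂ (to (∈-⟦⟧ above?) z∈above))) ⊥⊆
        , ⊆-antisym (λ z∈ → unsplit (x∈p∪q⁻ below above z∈)) (λ {z} z∈ → split z∈ (pos E z ≤? pos E x))

  cut-admissible : Admissible X 𝒯 cut
  cut-admissible = C.isTop
    , ⊆-by-Le top C.isTop (λ x∈ _ le → proj₁ (proj₂ (to (C.Le-⇔ x∈) le)))
    , (λ { Y (Y⊆X , conn) → Open-ext
        (∣-⊆-by-Le C.isTop top Y⊆X λ x∈ y∈ le →
          from (C.Le-⇔ (Y⊆X x∈)) (Y⊆X y∈ , le , connected⇒≼ Y⊆X conn x∈ y∈))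
        (∣-⊆-by-Le top C.isTop Y⊆X λ x∈ y∈ le → proj₁ (proj₂ (to (C.Le-⇔ (Y⊆X x∈)) le))) })
    , λ { x y (x∈ , y∈) → sim x∈ y∈ (Le? (quot X cut cut) x y ×-dec Le? (quot X cut cut) y x) }
    where
    sim : ∀ {x y} → x ∈ˢ X → y ∈ˢ X → Dec (Sim (quot X cut cut) x y) →
          (Sim (quot X 𝒯 cut) x y × Sim (quot X cut cut) x y) ⊎ (¬ Sim (quot X 𝒯 cut) x y × ¬ Sim (quot X cut cut) x y)
    sim x∈ y∈ (yes s@(p , q)) = inj₁ ((quot'⇒quot x∈ p , quot'⇒quot y∈ q) , s)
    -- Equivalence in 𝒯/cut puts x and y in the same block of `E` by `quot-mono`, so both chains can
    -- be reversed.
    sim x∈ y∈ (no ¬s) = inj₂ ((λ { (p , q) → ¬s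
      (quot-reverse y∈ q (quot-mono x∈ p) , quot-reverse x∈ p (quot-mono y∈ q)) }) , ¬s)

  cut-linExt : LinExt X cut D
  cut-linExt = d , λ x∈ y∈ le →
    let _ , le' , yEx = to (C.Le-⇔ x∈) le
        le″ , ge″ = proj₂ ext x∈ y∈ le'
        xEy , h = to (gl x∈ y∈) le″
    in h yEx , λ yDx → from (C.Le-⇔ y∈) (x∈ , ge″ (from (gl y∈ x∈) (yEx , λ _ → yDx)) , xEy)

  quot-cut-linExt : LinExt X (quot X 𝒯 cut) E
  quot-cut-linExt = e , λ x∈ y∈ le → quot-mono x∈ le , λ yEx → quot'⇒quot y∈ (quot-reverse x∈ le yEx)

-- Product

module _ {X Y : Subset N} {𝒯 𝒯' F : Fam N} (disj : X ∩ Y ≡ ∅) (top : IsTop X 𝒯) (top' : IsTop Y 𝒯')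
  (F-⇔ : ∀ {U} → Open F U ⇔ (U ⊆ X ∪ Y × Open 𝒯 (U ∩ X) × Open 𝒯' (U ∩ Y))) where

  -- An open set of 𝒯 has empty trace on `Y`, so it is open in the product; conversely opens of the
  -- product have open trace on `X`. As `F` enters only through `F-⇔`, exchanging the factors gives
  -- the statement on `Y`.
  Le-topProdˡ : x ∈ˢ X → Le F x y ⇔ Le 𝒯 x y
  Le-topProdˡ {x = x} x∈X = mk⇔
    (λ le U (o , x∈U) → let U⊆X = proj₁ (proj₂ (proj₂ top)) U o in
      le U (from F-⇔ ((λ z∈ → x∈p∪q⁺ (inj₁ (U⊆X z∈)))
        , subst (Open 𝒯) (⊆-antisym (λ z∈ → x∈p∩q⁺ (z∈ , U⊆X z∈)) (λ z∈ → proj₁ (x∈p∩q⁻ U X z∈))) o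
        , subst (Open 𝒯') (⊆-antisym ⊥⊆ λ z∈ → let z∈U , z∈Y = x∈p∩q⁻ U Y z∈ in
                             subst (_ ∈ˢ_) disj (x∈p∩q⁺ (U⊆X z∈U , z∈Y))) (proj₁ top')) , x∈U))
    λ le U (o , x∈U) → proj₁ (x∈p∩q⁻ U X (le (U ∩ X) (proj₁ (proj₂ (to F-⇔ o)) , x∈p∩q⁺ (x∈U , x∈X))))

Open-topProd : ∀ (X Y : Subset N) 𝒯 𝒯' {U} →
  Open (topProd X Y 𝒯 𝒯') U ⇔ (U ⊆ X ∪ Y × Open 𝒯 (U ∩ X) × Open 𝒯' (U ∩ Y))
Open-topProd X Y 𝒯 𝒯' = tabF-⇔ λ U →
  ⊆-reflects U (X ∪ Y) ×-reflects (Open-reflects 𝒯 (U ∩ X) ×-reflects Open-reflects 𝒯' (U ∩ Y))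

module _ {X Y : Subset N} {𝒯 𝒯' : Fam N} (disj : X ∩ Y ≡ ∅) (top : IsTop X 𝒯) (top' : IsTop Y 𝒯') where
  private
    F = topProd X Y 𝒯 𝒯'

    Open-flip : ∀ {U} → Open F U ⇔ (U ⊆ Y ∪ X × Open 𝒯' (U ∩ Y) × Open 𝒯 (U ∩ X))
    Open-flip {U} = mk⇔ fwd bwd
      where
      fwd : Open F U → U ⊆ Y ∪ X × Open 𝒯' (U ∩ Y) × Open 𝒯 (U ∩ X)
      fwd o = let U⊆ , oX , oY = to (Open-topProd X Y 𝒯 𝒯') o in subst (U ⊆_) (∪-comm X Y) U⊆ , oY , oX
      bwd : U ⊆ Y ∪ X × Open 𝒯' (U ∩ Y) × Open 𝒯 (U ∩ X) → Open F U
      bwd (U⊆ , oY , oX) = from (Open-topProd X Y 𝒯 𝒯') (subst (U ⊆_) (∪-comm Y X) U⊆ , oX , oY)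

    LeX : x ∈ˢ X → Le F x y ⇔ Le 𝒯 x y
    LeX = Le-topProdˡ disj top top' (Open-topProd X Y 𝒯 𝒯')

    LeY : x ∈ˢ Y → Le F x y ⇔ Le 𝒯' x y
    LeY = Le-topProdˡ (trans (∩-comm Y X) disj) top' top Open-flip

  ground-topProd : ground F ≡ X ∪ Y
  ground-topProd = ground-≡ F
    (from (Open-topProd X Y 𝒯 𝒯') (id
      , subst (Open 𝒯) (⊆-antisym (λ z∈ → x∈p∩q⁺ (x∈p∪q⁺ (inj₁ z∈) , z∈)) (λ z∈ → proj₂ (x∈p∩q⁻ (X ∪ Y) X z∈))) (proj₁ (proj₂ top))
      , subst (Open 𝒯') (⊆-antisym (λ z∈ → x∈p∩q⁺ (x∈p∪q⁺ (inj₂ z∈) , z∈)) (λ z∈ → proj₂ (x∈p∩q⁻ (X ∪ Y) Y z∈))) (proj₁ (proj₂ top'))))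
    λ U o → proj₁ (to (Open-topProd X Y 𝒯 𝒯') o)

  -- A relation of the product starting in `X` or in `Y` stays there, so mixed pairs impose no
  -- condition and the two restrictions carry all the others.
  topProd-linExt : LinExt (X ∪ Y) F C ⇔
    (Comp (X ∪ Y) C × LinExt X 𝒯 (restrictSC C X) × LinExt Y 𝒯' (restrictSC C Y))
  topProd-linExt {C = C} = mk⇔
    (λ { (c , h) → c
      , (Comp-restrict-⊆ c (λ z∈ → x∈p∪q⁺ (inj₁ z∈)) , λ x∈ y∈ le →
          let le' , ge' = h (x∈p∪q⁺ (inj₁ x∈)) (x∈p∪q⁺ (inj₁ y∈)) (from (LeX x∈) le) in
          from (restrict-≼ C x∈ y∈) le' , λ ge → to (LeX y∈) (ge' (to (restrict-≼ C y∈ x∈) ge)))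
      , (Comp-restrict-⊆ c (λ z∈ → x∈p∪q⁺ (inj₂ z∈)) , λ x∈ y∈ le →
          let le' , ge' = h (x∈p∪q⁺ (inj₂ x∈)) (x∈p∪q⁺ (inj₂ y∈)) (from (LeY x∈) le) in
          from (restrict-≼ C x∈ y∈) le' , λ ge → to (LeY y∈) (ge' (to (restrict-≼ C y∈ x∈) ge))) })
    (λ { (c , (_ , hX) , (_ , hY)) → c , λ x∈ y∈ le → cases hX hY le (x∈p∪q⁻ X Y x∈) })
    where
    cases : (∀ {x y} → x ∈ˢ X → y ∈ˢ X → Le 𝒯 x y → restrictSC C X ⊢ x ≼ y × (restrictSC C X ⊢ y ≼ x → Le 𝒯 y x)) →
            (∀ {x y} → x ∈ˢ Y → y ∈ˢ Y → Le 𝒯' x y → restrictSC C Y ⊢ x ≼ y × (restrictSC C Y ⊢ y ≼ x → Le 𝒯' y x)) →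
            Le F x y → x ∈ˢ X ⊎ x ∈ˢ Y → C ⊢ x ≼ y × (C ⊢ y ≼ x → Le F y x)
    cases hX hY le (inj₁ x∈) =
      let y∈ = Le-∈ top x∈ (to (LeX x∈) le)
          le' , ge' = hX x∈ y∈ (to (LeX x∈) le)
      in to (restrict-≼ C x∈ y∈) le' , λ ge → from (LeX y∈) (ge' (from (restrict-≼ C y∈ x∈) ge))
    cases hX hY le (inj₂ x∈) =
      let y∈ = Le-∈ top' x∈ (to (LeY x∈) le)
          le' , ge' = hY x∈ y∈ (to (LeY x∈) le)
      in to (restrict-≼ C x∈ y∈) le' , λ ge → from (LeY y∈) (ge' (from (restrict-≼ C y∈ x∈) ge))

-- Coproduct

take-length-++ : ∀ {A : Set} (as bs : List A) → take (length as) (as ++ bs) ≡ as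
take-length-++ []       bs = refl
take-length-++ (a ∷ as) bs = cong (a ∷_) (take-length-++ as bs)

drop-length-++ : ∀ {A : Set} (as bs : List A) → drop (length as) (as ++ bs) ≡ bs
drop-length-++ []       bs = refl
drop-length-++ (a ∷ as) bs = drop-length-++ as bs

module _ {X : Subset N} {𝒯 : Fam N} (top : IsTop X 𝒯) (A B : SC N) where

  -- A point of `X` outside `⋃ B` lies in `⋃ A`, strictly before all of `⋃ B`; so `⋃ B` is closed
  -- upwards, hence open. Concatenation keeps the order within each part.
  ++-linExt⁻ : LinExt X 𝒯 (A ++ B) →
    Open 𝒯 (⋃ B) × LinExt (X ∖ ⋃ B) (𝒯 ∣ (X ∖ ⋃ B)) A × LinExt (⋃ B) (𝒯 ∣ ⋃ B) B
  ++-linExt⁻ (c , h) = closed⇒Open top ⋃B⊆X up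
    , (subst (λ Z → Comp Z A) ⋃A≡ a , λ x∈ y∈ le →
        let le' , ge' = h (A⊆ x∈) (A⊆ y∈) (to (Le-∣ 𝒯 x∈ y∈) le)
            x∈A = subst (_ ∈ˢ_) (sym ⋃A≡) x∈
            y∈A = subst (_ ∈ˢ_) (sym ⋃A≡) y∈
        in to (≼-++ˡˡ A B x∈A y∈A) le' , λ ge → from (Le-∣ 𝒯 y∈ x∈) (ge' (from (≼-++ˡˡ A B y∈A x∈A) ge)))
    , (subst (λ Z → Comp Z B) (sym ⋃B≡) b , λ x∈ y∈ le →
        let le' , ge' = h (⋃B⊆X x∈) (⋃B⊆X y∈) (to (Le-∣ 𝒯 x∈ y∈) le)
        in to (≼-++ʳʳ A B (∉A x∈) (∉A y∈)) le' , λ ge → from (Le-∣ 𝒯 y∈ x∈) (ge' (from (≼-++ʳʳ A B (∉A y∈) (∉A x∈)) ge)))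
    where
    a = proj₁ (Comp-++⁻ A c)
    ⋃A⊆X : ⋃ A ⊆ X
    ⋃A⊆X = proj₁ (proj₂ (Comp-++⁻ A c))
    b = proj₂ (proj₂ (Comp-++⁻ A c))
    ⋃B≡ : ⋃ B ≡ X ∖ ⋃ A
    ⋃B≡ = ⋃-Comp b
    ∉A : ∀ {z} → z ∈ˢ ⋃ B → z ∉ˢ ⋃ A
    ∉A z∈ = proj₂ (∈-∖⁻ {X = X} (subst (_ ∈ˢ_) ⋃B≡ z∈))
    ⋃B⊆X : ⋃ B ⊆ X
    ⋃B⊆X z∈ = proj₁ (∈-∖⁻ {X = X} (subst (_ ∈ˢ_) ⋃B≡ z∈))
    A⊆ : X ∖ ⋃ B ⊆ X
    A⊆ z∈ = proj₁ (∈-∖⁻ {X = X} z∈)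
    in-A : ∀ {z} → z ∈ˢ X → z ∉ˢ ⋃ B → z ∈ˢ ⋃ A
    in-A {z} z∈X z∉B with z ∈? ⋃ A
    ... | yes z∈A = z∈A
    ... | no z∉A  = contradiction (subst (z ∈ˢ_) (sym ⋃B≡) (∈-∖⁺ z∈X z∉A)) z∉B
    ⋃A≡ : ⋃ A ≡ X ∖ ⋃ B
    ⋃A≡ = ⊆-antisym (λ z∈ → ∈-∖⁺ (⋃A⊆X z∈) (λ z∈B → ∉A z∈B z∈))
                    (λ z∈ → let z∈X , z∉B = ∈-∖⁻ {X = X} z∈ in in-A z∈X z∉B)
    up : ∀ {x y} → x ∈ˢ ⋃ B → y ∈ˢ X → Le 𝒯 x y → y ∈ˢ ⋃ B
    up {x} {y} x∈ y∈ le with y ∈? ⋃ B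
    ... | yes y∈B = y∈B
    ... | no y∉B  = contradiction (proj₁ (h (⋃B⊆X x∈) y∈ le)) (<⇒≱ (pos-< A B (in-A y∈ y∉B) (∉A x∈)))

  ++-linExt⁺ : Open 𝒯 Y → LinExt (X ∖ Y) (𝒯 ∣ (X ∖ Y)) A → LinExt Y (𝒯 ∣ Y) B → LinExt X 𝒯 (A ++ B)
  ++-linExt⁺ {Y = Y} oY (a , hA) (b , hB) =
    Comp-++⁺ a (λ z∈ → proj₁ (∈-∖⁻ {X = X} z∈)) (Comp-resp
      (λ z∈ → ∈-∖⁺ (Y⊆X z∈) (λ z∈' → proj₂ (∈-∖⁻ {X = X} z∈') z∈))
      (λ z∈ → let z∈X , z∉ = ∈-∖⁻ {X = X} z∈ in in-Y z∈X z∉) b)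
    , λ {x} {y} x∈ y∈ le → cases x∈ y∈ le (x ∈? Y) (y ∈? Y)
    where
    Y⊆X : Y ⊆ X
    Y⊆X = proj₁ (proj₂ (proj₂ top)) Y oY
    in-Y : ∀ {z} → z ∈ˢ X → z ∉ˢ X ∖ Y → z ∈ˢ Y
    in-Y {z} z∈X z∉ with z ∈? Y
    ... | yes z∈Y = z∈Y
    ... | no z∉Y  = contradiction (∈-∖⁺ z∈X z∉Y) z∉
    ∈A : ∀ {z} → z ∈ˢ X → z ∉ˢ Y → z ∈ˢ ⋃ A
    ∈A z∈ z∉ = subst (_ ∈ˢ_) (sym (⋃-Comp a)) (∈-∖⁺ z∈ z∉)
    ∉A : ∀ {z} → z ∈ˢ Y → z ∉ˢ ⋃ A
    ∉A z∈ z∈A = proj₂ (∈-∖⁻ {X = X} (subst (_ ∈ˢ_) (⋃-Comp a) z∈A)) z∈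
    cases : ∀ {x y} → x ∈ˢ X → y ∈ˢ X → Le 𝒯 x y → Dec (x ∈ˢ Y) → Dec (y ∈ˢ Y) →
            A ++ B ⊢ x ≼ y × (A ++ B ⊢ y ≼ x → Le 𝒯 y x)
    cases x∈ y∈ le (yes x∈Y) (no y∉Y)  = contradiction (le Y (oY , x∈Y)) y∉Y
    cases x∈ y∈ le (yes x∈Y) (yes y∈Y) = let le' , ge' = hB x∈Y y∈Y (from (Le-∣ 𝒯 x∈Y y∈Y) le) in
        from (≼-++ʳʳ A B (∉A x∈Y) (∉A y∈Y)) le'
      , λ ge → to (Le-∣ 𝒯 y∈Y x∈Y) (ge' (to (≼-++ʳʳ A B (∉A y∈Y) (∉A x∈Y)) ge))
    cases x∈ y∈ le (no x∉Y) (yes y∈Y)  = let lt = pos-< A B (∈A x∈ x∉Y) (∉A y∈Y) in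
      <⇒≤ lt , λ ge → contradiction ge (<⇒≱ lt)
    cases x∈ y∈ le (no x∉Y) (no y∉Y)   =
      let x∈' = ∈-∖⁺ x∈ x∉Y
          y∈' = ∈-∖⁺ y∈ y∉Y
          le' , ge' = hA x∈' y∈' (from (Le-∣ 𝒯 x∈' y∈') le)
      in from (≼-++ˡˡ A B (∈A x∈ x∉Y) (∈A y∈ y∉Y)) le'
       , λ ge → to (Le-∣ 𝒯 y∈' x∈') (ge' (to (≼-++ˡˡ A B (∈A y∈ y∉Y) (∈A x∈ x∉Y)) ge))

-- Coarsenings

Comp-coarsen : ∀ segs → All NonNil segs → Comp X (concat segs) → Comp X (map ⋃ segs)
Comp-coarsen [] [] (nil ∉X) = nil ∉X
Comp-coarsen ([] ∷ segs) (n ∷ _) _ = contradiction refl n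
Comp-coarsen (s@(B ∷ C) ∷ segs) (_ ∷ nn) c with Comp-++⁻ s c
... | cons (x , x∈) B⊆ _ , s⊆X , rest = cons (x , B⊆ x∈) s⊆X (Comp-coarsen segs nn rest)

-- A converse to coarsening: cutting `D` along the blocks of `E` gives the segmentation of
-- `glue D E` that contributes D ⊗ E to the internal coproduct.
segments-⋃ : Comp X D → Comp Y E → Y ⊆ X →
  map ⋃ (map (restrictSC D) E) ≡ E × All NonNil (map (restrictSC D) E)
segments-⋃ d (nil _) _ = refl , []
segments-⋃ {D = D} {Y = Y} d (cons {B = B} (x , x∈) B⊆Y e) Y⊆X =
  let eq , nn = segments-⋃ d e (λ z∈ → Y⊆X (proj₁ (∈-∖⁻ {X = Y} z∈)))
      eB = ⋃-restrict d (λ z∈ → Y⊆X (B⊆Y z∈))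
  in cong₂ _∷_ eB eq , (λ nil≡ → ∉⊥ (subst (x ∈ˢ_) (trans (sym eB) (cong ⋃ nil≡)) x∈)) ∷ nn

-- The topology whose only linear extension is C

module _ {X : Subset N} {C : SC N} (c : Comp X C) where
  private
    Below : Fin N → Fin N → Set
    Below x y = y ∈ˢ X × C ⊢ x ≼ y

    Below? : ∀ x y → Dec (Below x y)
    Below? x y = (y ∈? X) ×-dec (pos C x ≤? pos C y)

    Below-refl : ∀ {x} → x ∈ˢ X → Below x x
    Below-refl x∈ = x∈ , ≤-refl

    Below-trans : ∀ {x y z} → Below x y → Below y z → Below x z
    Below-trans (_ , p) (z∈ , q) = z∈ , ≤-trans p q

    module P = Preorder X Below? proj₁ Below-refl Below-trans

  -- Its opens are the unions of final runs of blocks of `C`.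
  chain : Fam N
  chain = P.topology

  chain-isTop : IsTop X chain
  chain-isTop = P.isTop

  chain-linExt : ∀ D → LinExt X chain D ⇔ D ≡ C
  chain-linExt D = mk⇔
    (λ { (d , h) → sym (pos-order-unique c d λ {x} {y} x∈ y∈ → mk⇔
        (λ le → proj₁ (h x∈ y∈ (from (P.Le-⇔ x∈) (y∈ , le))))
        (λ le → reverse h x∈ y∈ le (≤-total (pos C x) (pos C y)))) })
    (λ { refl → c , λ x∈ y∈ le → proj₂ (to (P.Le-⇔ x∈) le) , λ ge → from (P.Le-⇔ y∈) (x∈ , ge) })
    where
    reverse : (∀ {x y} → x ∈ˢ X → y ∈ˢ X → Le chain x y → D ⊢ x ≼ y × (D ⊢ y ≼ x → Le chain y x)) →
              ∀ {x y} → x ∈ˢ X → y ∈ˢ X → D ⊢ x ≼ y → C ⊢ x ≼ y ⊎ C ⊢ y ≼ x → C ⊢ x ≼ y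
    reverse h x∈ y∈ le (inj₁ p) = p
    -- By totality y lies below x in `chain`; as `D` puts x no later than y, the second clause of
    -- `LinExt` turns this relation around.
    reverse h x∈ y∈ le (inj₂ q) = proj₂ (to (P.Le-⇔ x∈) (proj₂ (h y∈ x∈ (from (P.Le-⇔ y∈) (x∈ , q))) le))

-- The identities between vectors, and surjectivity

module Morphism {c ℓ} (K : Field c ℓ) {N : ℕ} where
  open Maps K {N}
  open Representation K
  open Field K using (_≈_; _+_; _*_; 1#; +-cong; *-cong; +-identityʳ; +-identityˡ; *-identityʳ; zeroʳ) renaming (refl to ≈-refl; trans to ≈-trans)

  L-represents : {X : Subset N} {𝒯 : Fam N} → ground 𝒯 ≡ X → L 𝒯 Represents LinExt X 𝒯
  L-represents {𝒯 = 𝒯} e = sumᵥ-represents (linExts-unique 𝒯) λ _ → ∈-linExts e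

  scProd-represents : ∀ C' C'' → scProd C' C'' Represents
    (λ C → Comp (⋃ C' ∪ ⋃ C'') C × restrictSC C (⋃ C') ≡ C' × restrictSC C (⋃ C'') ≡ C'')
  scProd-represents C' C'' = sumᵥ-represents
    (Uniqueₚ.filter⁺ (T? ∘ shuffleᵇ) (allSC-unique XY))
    λ C → mk⇔ (λ C∈ → let C∈' , e = to mem C∈ in to (∈-allSC XY) C∈' , e)
              (λ { (c , e) → from mem (from (∈-allSC XY) c , e) })
    where
    XY = ⋃ C' ∪ ⋃ C''
    shuffleᵇ : SC N → Bool
    shuffleᵇ C = does (restrictSC C (⋃ C') ≟SC C') ∧ does (restrictSC C (⋃ C'') ≟SC C'')
    mem : ∀ {C} → C ∈ filterᵇ shuffleᵇ (allSC XY)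
              ⇔ (C ∈ allSC XY × restrictSC C (⋃ C') ≡ C' × restrictSC C (⋃ C'') ≡ C'')
    mem = filterᵇ-∈-⇔ λ C → proof (restrictSC C (⋃ C') ≟SC C') ×-reflects proof (restrictSC C (⋃ C'') ≟SC C'')

  L-product : (X Y : Subset N) (𝒯 𝒯' : Fam N) → X ∩ Y ≡ ∅ → IsTop X 𝒯 → IsTop Y 𝒯' →
              L (topProd X Y 𝒯 𝒯') ≈𝕊ℂ (L 𝒯 · L 𝒯')
  L-product X Y 𝒯 𝒯' disj top top' = represents⇒Eq _≟SC_
    (represents-cong (λ C → topProd-linExt disj top top') (L-represents (ground-topProd disj top top')))
    (represents-cong (λ C → mk⇔ (fwd C) (bwd C))
      (bilin-represents (L-represents (ground-top top)) (L-represents (ground-top top'))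
        (λ {A} {B} _ _ → scProd-represents A B)
        -- A shuffle `C` determines both factors, as its restrictions to `X` and `Y`.
        λ { {c = C} (a , _) (a' , _) (b , _) (b' , _) (_ , p , q) (_ , p' , q') →
          unique {C = C} a a' p p' , unique {C = C} b b' q q' }))
    where
    unique : ∀ {Z A A' C} → Comp Z A → Comp Z A' → restrictSC C (⋃ A) ≡ A → restrictSC C (⋃ A') ≡ A' → A ≡ A'
    unique {C = C} a a' p p' = trans (sym p) (trans (cong (restrictSC C) (trans (⋃-Comp a) (sym (⋃-Comp a')))) p')
    fwd : ∀ C → _ → _
    fwd C (A , lA@(a , _) , B , lB@(b , _) , m , p , q) =
      subst₂ (λ U V → Comp (U ∪ V) C) (⋃-Comp a) (⋃-Comp b) m
      , subst (LinExt X 𝒯) (trans (sym p) (cong (restrictSC C) (⋃-Comp a))) lA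
      , subst (LinExt Y 𝒯') (trans (sym q) (cong (restrictSC C) (⋃-Comp b))) lB
    bwd : ∀ C → _ → _
    bwd C (m , lA@(a , _) , lB@(b , _)) = restrictSC C X , lA , restrictSC C Y , lB
      , subst₂ (λ U V → Comp (U ∪ V) C) (sym (⋃-Comp a)) (sym (⋃-Comp b)) m
      , cong (restrictSC C) (⋃-Comp a) , cong (restrictSC C) (⋃-Comp b)

  ΔSC-represents : ∀ C → ΔSC C Represents (λ p → proj₁ p ++ proj₂ p ≡ C)
  ΔSC-represents C = sumᵥ-represents
    -- Different cuts give different pairs, since for i up to `length C` the first part has length
    -- exactly i.
    (map-unique (Uniqueₚ.upTo⁺ _) λ {i} {j} i∈ j∈ e →
      trans (sym (len i i∈)) (trans (cong (length ∘ proj₁) e) (len j j∈)))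
    λ { (A , B) → mk⇔
      (λ p∈ → let i , _ , e = ∈-map⁻ split {xs = upTo (suc (length C))} p∈ in
        trans (cong₂ _++_ (cong proj₁ e) (cong proj₂ e)) (take++drop≡id i C))
      (λ { refl → subst (_∈ map split (upTo (suc (length C))))
        (cong₂ _,_ (take-length-++ A B) (drop-length-++ A B))
        (∈-map⁺ split (∈-upTo⁺ (s≤s (subst (length A ≤_) (sym (length-++ A)) (m≤m+n _ _))))) }) }
    where
    split : ℕ → SC N × SC N
    split i = take i C , drop i C
    len : ∀ i → i ∈ upTo (suc (length C)) → length (take i C) ≡ i
    len i i∈ = trans (length-take i C) (m≤n⇒m⊓n≡m (s≤s⁻¹ (∈-upTo⁻ i∈)))

  L-coproduct : (X : Subset N) (𝒯 : Fam N) → IsTop X 𝒯 → lin ΔSC (L 𝒯) ≈𝕊ℂ⊗𝕊ℂ (L ⊗ₗ L) (Δ𝕋 X 𝒯)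
  L-coproduct X 𝒯 top = represents⇒Eq _
    (lin-represents (L-represents (ground-top top)) (λ _ → ΔSC-represents _) λ { _ _ refl refl → refl })
    (represents-cong (λ p → mk⇔ (fwd p) (bwd p))
      (lin-represents
        (sumᵥ-represents {P = Pieces} (map-unique (opens-unique 𝒯) λ Y∈ Y'∈ e → trans (sym (ground-piece (to (∈-opens 𝒯) Y∈)))
            (trans (cong (ground ∘ proj₂) e) (ground-piece (to (∈-opens 𝒯) Y'∈))))
          λ p → mk⇔ (λ p∈ → let Y , Y∈ , e = ∈-map⁻ _ p∈ in Y , to (∈-opens 𝒯) Y∈ , e)
                    (λ { (Y , oY , refl) → ∈-map⁺ _ (from (∈-opens 𝒯) oY) }))
        (λ _ → ⊗-represents (L-represents refl) (L-represents refl))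
        -- `Y` is recovered from the second tensor factor: the union of its blocks is the ground set
        -- of `𝒯 ∣ Y`.
        λ { (Y , oY , refl) (Y' , oY' , refl) (_ , (b , _)) (_ , (b' , _)) →
            cong (λ Z → (𝒯 ∣ (X ∖ Z)) , (𝒯 ∣ Z)) (trans (sym (ground-piece oY))
              (trans (trans (sym (⋃-Comp b)) (⋃-Comp b')) (ground-piece oY'))) }))
    where
    Pieces : Fam N × Fam N → Set
    Pieces p = ∃ λ Y → Open 𝒯 Y × p ≡ ((𝒯 ∣ (X ∖ Y)) , (𝒯 ∣ Y))
    ground-piece : ∀ {Y} → Open 𝒯 Y → ground (𝒯 ∣ Y) ≡ Y
    ground-piece oY = ground-∣ top (proj₁ (proj₂ (proj₂ top)) _ oY)
    ground-copiece : ∀ Y → ground (𝒯 ∣ (X ∖ Y)) ≡ X ∖ Y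
    ground-copiece Y = ground-∣ top λ z∈ → proj₁ (∈-∖⁻ {X = X} z∈)
    fwd : ∀ p → _ → _
    fwd (A , B) (_ , (Y , oY , refl) , lA , lB) = A ++ B
      , ++-linExt⁺ top A B oY (subst (λ Z → LinExt Z (𝒯 ∣ (X ∖ Y)) A) (ground-copiece Y) lA)
          (subst (λ Z → LinExt Z (𝒯 ∣ Y) B) (ground-piece oY) lB)
      , refl
    bwd : ∀ p → _ → _
    bwd (A , B) (_ , l , refl) = let o , lA , lB = ++-linExt⁻ top A B l in
      _ , (⋃ B , o , refl) , subst (λ Z → LinExt Z (𝒯 ∣ (X ∖ ⋃ B)) A) (sym (ground-copiece (⋃ B))) lA
      , subst (λ Z → LinExt Z (𝒯 ∣ ⋃ B) B) (sym (ground-piece o)) lB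

  -- An iterated shuffle is characterised by its restrictions to the unions of the segments. The
  -- recursion sees `D` only through its restriction to the union of the remaining segments, and
  -- restricting in two stages agrees with restricting once.
  prodMany-represents : ∀ segs → prodMany segs Represents
    (λ D → Comp (⋃ (map ⋃ segs)) D × map (restrictSC D) (map ⋃ segs) ≡ segs)
  prodMany-represents [] = represents-cong
    (λ D → mk⇔ (λ { refl → nil (λ _ → ∉⊥) , refl }) (λ { (nil _ , _) → refl ; (cons (_ , x∈) ⊆∅ _ , _) → contradiction (⊆∅ x∈) ∉⊥ }))
    (single-represents [])
  prodMany-represents (C ∷ Cs) = represents-cong (λ D → mk⇔ (fwd D) (bwd D))
    (bilin-represents (single-represents C) (prodMany-represents Cs) (λ {A} {B} _ _ → scProd-represents A B)
      λ { {c = D} refl refl (b , _) (b' , _) (_ , _ , q) (_ , _ , q') →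
        refl , trans (sym q) (trans (cong (restrictSC D) (trans (⋃-Comp b) (sym (⋃-Comp b')))) q') })
    where
    rest = ⋃ (map ⋃ Cs)
    restrict-all : ∀ D Es → (∀ {Y} → Y ∈ Es → Y ⊆ rest) → map (restrictSC (restrictSC D rest)) Es ≡ map (restrictSC D) Es
    restrict-all D []       _ = refl
    restrict-all D (Y ∷ Es) h = cong₂ _∷_ (restrict-restrict D (h (here refl))) (restrict-all D Es (h ∘ there))
    restrict-Cs : ∀ D → map (restrictSC (restrictSC D rest)) (map ⋃ Cs) ≡ map (restrictSC D) (map ⋃ Cs)
    restrict-Cs D = restrict-all D (map ⋃ Cs) λ Y∈ → ∈-⋃⁺ Y∈
    fwd : ∀ D → _ → _
    fwd D (_ , refl , D' , (d' , e') , (d , p , q)) =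
        subst (λ U → Comp (⋃ C ∪ U) D) (⋃-Comp d') d
      , cong₂ _∷_ p (trans (sym (restrict-Cs D)) (trans (cong (λ F → map (restrictSC F) (map ⋃ Cs))
          (trans (cong (restrictSC D) (sym (⋃-Comp d'))) q)) e'))
    bwd : ∀ D → _ → _
    bwd D (d , e) = C , refl , restrictSC D rest , (d' , trans (restrict-Cs D) (∷-injectiveʳ e))
      , (subst (λ U → Comp (⋃ C ∪ U) D) (sym (⋃-Comp d')) d , ∷-injectiveˡ e , cong (restrictSC D) (⋃-Comp d'))
      where
      d' : Comp rest (restrictSC D rest)
      d' = Comp-restrict-⊆ d (λ z∈ → x∈p∪q⁺ (inj₂ z∈))

  Segments : SC N × SC N → List (SC N) → Set
  Segments (D , E) segs = (Comp (⋃ (map ⋃ segs)) D × map (restrictSC D) (map ⋃ segs) ≡ segs) × E ≡ map ⋃ segs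

  -- The segments are `D` cut along the blocks of `E`. This keeps the terms of one internal
  -- coproduct distinct, and also those of different set compositions, each being the concatenation
  -- of its segments.
  Segments-unique : ∀ {p s s'} → Segments p s → Segments p s' → s ≡ s'
  Segments-unique {D , E} ((_ , e) , f) ((_ , e') , f') =
    trans (sym e) (trans (cong (map (restrictSC D)) (trans (sym f) f')) e')

  ρSC-represents : ∀ C → ρSC C Represents
    (λ p → ∃ λ segs → (concat segs ≡ C × All NonNil segs) × Segments p segs)
  ρSC-represents C = concatMap-represents {κ = id} {Q = λ segs p → Segments p segs}
    (subst Unique (sym (map-id (segmentations C))) (segmentations-unique C))
    (λ segs → subst (λ ss → segs ∈ ss ⇔ (concat segs ≡ C × All NonNil segs)) (sym (map-id (segmentations C)))
      (mk⇔ (segmentations-concat C) λ { (e , nn) → ∈-segmentations C nn e }))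
    (λ {segs} _ → ⊗-represents (prodMany-represents segs) (single-represents _))
    λ _ _ → Segments-unique

  Γ-represents : ∀ X 𝒯 → Γ X 𝒯 Represents (λ p → ∃ λ 𝒯' → Admissible X 𝒯 𝒯' × p ≡ (𝒯' , quot X 𝒯 𝒯'))
  Γ-represents X 𝒯 = sumᵥ-represents
    (Uniqueₚ.map⁺ {f = pair} (cong proj₁) (Uniqueₚ.filter⁺ (T? ∘ admissibleᵇ X 𝒯) (allFams-unique N)))
    λ p → mk⇔ (fwd p) (bwd p)
    where
    pair : Fam N → Fam N × Fam N
    pair 𝒯' = 𝒯' , quot X 𝒯 𝒯'
    admissibles = filterᵇ (admissibleᵇ X 𝒯) (allFams N)
    mem : ∀ {𝒯'} → 𝒯' ∈ admissibles ⇔ (𝒯' ∈ allFams N × Admissible X 𝒯 𝒯')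
    mem = filterᵇ-∈-⇔ (admissible-reflects X 𝒯)
    fwd : ∀ p → p ∈ map pair admissibles → ∃ λ 𝒯' → Admissible X 𝒯 𝒯' × p ≡ pair 𝒯'
    fwd p p∈ = let 𝒯' , m , e = ∈-map⁻ pair p∈ in 𝒯' , proj₂ (to (mem {𝒯'}) m) , e
    bwd : ∀ p → (∃ λ 𝒯' → Admissible X 𝒯 𝒯' × p ≡ pair 𝒯') → p ∈ map pair admissibles
    bwd p (𝒯' , a , refl) = ∈-map⁺ pair (from (mem {𝒯'}) (∈-allFams 𝒯' , a))

  L-internal-coproduct : (X : Subset N) (𝒯 : Fam N) → IsTop X 𝒯 → lin ρSC (L 𝒯) ≈𝕊ℂ⊗𝕊ℂ (L ⊗ₗ L) (Γ X 𝒯)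
  L-internal-coproduct X 𝒯 top = represents⇒Eq _
    (represents-cong {Q = Middle} (λ p → mk⇔ (fwd p) (bwd p))
      (lin-represents (L-represents (ground-top top)) (λ _ → ρSC-represents _)
        λ { _ _ (s , (e , _) , r) (s' , (e' , _) , r') → trans (sym e) (trans (cong concat (Segments-unique r r')) e') }))
    (represents-cong {Q = Middle} (λ p → mk⇔ (fwd' p) (bwd' p))
      (lin-represents {Q = λ q p → LinExt X (proj₁ q) (proj₁ p) × LinExt X (proj₂ q) (proj₂ p)} (Γ-represents X 𝒯)
        (λ { (𝒯' , a , refl) → ⊗-represents (L-represents (ground-top (proj₁ a)))
               (L-represents (ground-top (Quotient.quot-isTop X 𝒯 𝒯'))) })
        λ { (_ , a , refl) (_ , a' , refl) (_ , e) (_ , e') →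
            cong (λ F → F , quot X 𝒯 F) (admissible-unique a a' e e') }))
    where
    Middle : SC N × SC N → Set
    Middle (D , E) = Comp X D × Comp X E × LinExt X 𝒯 (glue D E)
    fwd : ∀ p → _ → Middle p
    fwd (D , E) (_ , l , segs , (refl , nn) , (d , e) , refl) =
        subst (λ Z → Comp Z D) (⋃-Comp E-comp) d , E-comp , subst (LinExt X 𝒯 ∘ concat) (sym e) l
      where
      E-comp : Comp X (map ⋃ segs)
      E-comp = Comp-coarsen segs nn (proj₁ l)
    bwd : ∀ p → Middle p → _
    bwd (D , E) (d , e , l) = let eq , nn = segments-⋃ d e id in
      glue D E , l , map (restrictSC D) E , (refl , nn)
      , (subst (λ Z → Comp Z D) (sym (trans (cong ⋃ eq) (⋃-Comp e))) d , cong (map (restrictSC D)) eq) , sym eq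
    fwd' : ∀ p → _ → Middle p
    fwd' (D , E) (_ , (𝒯' , a , refl) , lD , lE) = proj₁ lD , proj₁ lE , admissible⇒glue a lD lE
    bwd' : ∀ p → Middle p → _
    bwd' (D , E) (d , e , l) = _ , (cut top d e l , cut-admissible top d e l , refl)
      , cut-linExt top d e l , quot-cut-linExt top d e l

  -- The vector may repeat basis elements with arbitrary coefficients, so `_Represents_` applies
  -- only to single terms: each `C` is replaced by its `chain`, whose image is `C` alone, and
  -- coefficients are added up term by term.
  L-surjective : (X : Subset N) (v : Vec𝕊ℂ) → All (λ p → IsSetComposition X (proj₂ p)) v →
    Σ Vec𝕋 (λ w → All (λ p → IsTopology X (proj₂ p)) w × (Lˡ w ≈𝕊ℂ v))
  L-surjective X [] [] = [] , [] , λ _ → ≈-refl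
  L-surjective X ((r , C) ∷ v) (t ∷ ts) with L-surjective X v ts
  ... | w , tops , eq = (r , chain comp) ∷ w , T-reflect (isTop-reflects X (chain comp)) (chain-isTop comp) ∷ tops , λ b →
    ≈-trans (coeff-++ _≟SC_ b (scale r (L (chain comp))) (Lˡ w))
    (≈-trans (+-cong (≈-trans (coeff-scale _≟SC_ b r (L (chain comp)))
       (*-cong ≈-refl (represents⇒Eq _≟SC_ (represents-cong (chain-linExt comp) (L-represents (ground-top (chain-isTop comp))))
         (single-represents C) b))) (eq b)) (last b))
    where
    comp = isSC⇒Comp X C t
    last : ∀ b → r * coeff _≟SC_ b (single C) + coeff _≟SC_ b v ≈ coeff _≟SC_ b ((r , C) ∷ v)
    last b with b ≟SC C
    ... | yes _ = +-cong (≈-trans (*-cong ≈-refl (+-identityʳ 1#)) (*-identityʳ r)) ≈-refl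
    ... | no _  = ≈-trans (+-cong (zeroʳ r) ≈-refl) (+-identityˡ _)

theorem5p5 : ∀ {c ℓ} (K : Field c ℓ) →
    (∀ (N : ℕ) (X Y : Subset N) (𝒯 𝒯' : Fam N) →
    X ∩ Y ≡ ∅ → IsTopology X 𝒯 → IsTopology Y 𝒯' →
    let open Maps K {N} in
    L (topProd X Y 𝒯 𝒯') ≈𝕊ℂ (L 𝒯 · L 𝒯'))
    × (∀ (N : ℕ) (X : Subset N) (𝒯 : Fam N) → IsTopology X 𝒯 →
    let open Maps K {N} in
    lin ΔSC (L 𝒯) ≈𝕊ℂ⊗𝕊ℂ (L ⊗ₗ L) (Δ𝕋 X 𝒯))
    × (∀ (N : ℕ) (X : Subset N) (𝒯 : Fam N) → IsTopology X 𝒯 →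
    let open Maps K {N} in
    lin ρSC (L 𝒯) ≈𝕊ℂ⊗𝕊ℂ (L ⊗ₗ L) (Γ X 𝒯))
    × (∀ (N : ℕ) (X : Subset N) (v : FreeVS.Vect K (SC N)) →
    All (λ p → IsSetComposition X (proj₂ p)) v →
    let open Maps K {N} in
    Σ Vec𝕋 (λ w → All (λ p → IsTopology X (proj₂ p)) w × (Lˡ w ≈𝕊ℂ v)))
theorem5p5 K =
    (λ N X Y 𝒯 𝒯' disj t t' → L-product X Y 𝒯 𝒯' disj
      (reflect-T (isTop-reflects X 𝒯) t) (reflect-T (isTop-reflects Y 𝒯') t'))
  , (λ N X 𝒯 t → L-coproduct X 𝒯 (reflect-T (isTop-reflects X 𝒯) t))
  , (λ N X 𝒯 t → L-internal-coproduct X 𝒯 (reflect-T (isTop-reflects X 𝒯) t))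
  , (λ N → L-surjective)
  where open Morphism K
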